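{- Let $d$ be a positive integer and $\Delta$ an integer with $\Delta\ge 6.21d$. Every $d$-degenerate graph $G$ with $\Delta(G)\le\Delta$ has an equitable $\Delta$-coloring.
   Context: All graphs are finite and simple. A graph is $d$-degenerate if every subgraph of it has a vertex of degree at most $d$. $\Delta(G)$ is the maximum degree of $G$. An equitable $r$-coloring of $G$ is a partition of $V(G)$ into $r$ independent sets whose sizes pairwise differ by at most one. -}

module Defs where

open import Data.Nat using (ℕ; zero; suc; _+_; _≤_)
open import Data.Fin using (Fin; zero; suc)
open import Data.Bool using (Bool; true; false; _∧_; T)
open import Data.Product using (Σ; _×_; ∃)
open import Relation.Binary.PropositionalEquality using (_≡_; _≢_)
open import Relation.Nullary using (¬_; does)
open import Data.Fin using (_≟_)

count : ∀ {n} → (Fin n → Bool) → ℕ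
count {zero}  p = 0
count {suc n} p with p zero
... | true  = suc (count (λ i → p (suc i)))
... | false = count (λ i → p (suc i))

record Graph (n : ℕ) : Set where
  field
    adj     : Fin n → Fin n → Bool
    sym     : ∀ u v → adj u v ≡ adj v u
    irrefl  : ∀ v → adj v v ≡ false
open Graph public

degree : ∀ {n} → Graph n → Fin n → ℕ
degree G v = count (adj G v)

MaxDegreeAtMost : ∀ {n} → Graph n → ℕ → Set
MaxDegreeAtMost G Δ = ∀ v → degree G v ≤ Δ

record Subgraph {n : ℕ} (G : Graph n) : Set where
  field
    vert   : Fin n → Bool
    edge   : Fin n → Fin n → Bool
    esym   : ∀ u v → edge u v ≡ edge v u
    eadj   : ∀ u v → T (edge u v) → T (adj G u v)
    evert  : ∀ u v → T (edge u v) → T (vert u) × T (vert v)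
open Subgraph public

subDegree : ∀ {n} {G : Graph n} → Subgraph G → Fin n → ℕ
subDegree H v = count (edge H v)

Degenerate : ∀ {n} → ℕ → Graph n → Set
Degenerate d G = (H : Subgraph G) → ∃ (λ u → T (vert H u)) →
                 ∃ (λ v → T (vert H v) × subDegree H v ≤ d)

classSize : ∀ {n r} → (Fin n → Fin r) → Fin r → ℕ
classSize c i = count (λ v → does (c v ≟ i))

-- equitable r-colouring: proper colouring with class sizes differing by ≤ 1
-- (colour classes = the partition into r independent sets; empty classes allowed)
EquitableColoring : ∀ {n} → Graph n → (r : ℕ) → Set
EquitableColoring {n} G r =
  Σ (Fin n → Fin r) λ c →
    (∀ u v → T (adj G u v) → c u ≢ c v) ×
    (∀ i j → classSize c i ≤ suc (classSize c j))

{-# OPTIONS --safe #-}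

-- Write r = Δ.  Colour the vertices one at a time along a degeneracy order, keeping the
-- colouring equitable, with classes of size q or q + 1; let v be the next vertex, so v has at most
-- d coloured neighbours, and let W be a class of size q.  Draw an arc V → U between classes when
-- some vertex of V has no neighbour in U; moving vertices along a path of arcs transfers one unit
-- of size.  If v misses a class from which a class of size q is reachable, v can be inserted.
-- Otherwise let A be the set of the a ≤ d such classes and 𝒞 the set of the at least r − d classes
-- missed by v: every vertex of a class outside A has a neighbour in every class of A, W included.
--
-- Call a vertex solo if it has exactly one neighbour in W.  If z ∈ W has nonadjacent solo
-- neighbours y, y′ in classes Y, Y′ of 𝒞, then y and y′ may replace z in W, v goes to one of Y, Y′
-- and z may go to any class that it misses and that reaches the other one (or to Y if y is its only
-- neighbour there); this extends the colouring to v.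
--
-- A set of classes of 𝒞 with no arc entering it forces one edge per vertex and class
-- across its boundary, so by sparsity it contains few of the classes of 𝒞 or almost all of them.
-- Let X be a small such set into which no further small one can be merged.  Then a class of 𝒞
-- outside X is reachable from almost all of 𝒞.  If no z ∈ W admits an exchange, then each z has
-- at most d + 1 solo neighbours outside X, or hits almost all classes of 𝒞 and wastes degree on
-- repeated or non-solo neighbours.  With weights on the vertices outside A this bounds the weight of
-- the neighbourhood of each of the q vertices z ∈ W by R > 0, although these q weights sum to at
-- least (q + 1) R.
module Submission where

open import Defs hiding (sym)
open import Data.Bool using (Bool; true; false; T; _∧_; _∨_; not; if_then_else_)
open import Data.Bool.Properties using (∧-zeroʳ; ∧-identityʳ)
open import Data.Empty using (⊥; ⊥-elim)
open import Data.Fin using (Fin; zero; suc; _≟_; fromℕ<)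
open import Data.Fin.Properties using (any?)
open import Data.Maybe using (Maybe; just; nothing; is-just)
open import Data.Maybe.Properties using (just-injective; ≡-dec)
open import Data.Nat hiding (_≟_)
open import Data.Nat.Properties hiding (_≟_)
open import Data.Nat.Tactic.RingSolver using (solve-∀)
open import Data.Product using (_,_; _×_; proj₁; proj₂; ∃-syntax)
open import Data.Sum using (_⊎_; inj₁; inj₂)
open import Function using (_∘_; mk⇔)
open import Relation.Nullary using (contradiction; yes; no; does; Dec)
open import Relation.Nullary.Decidable using (dec-true; dec-false; _×-dec_; does-⇔)
open import Relation.Binary.PropositionalEquality
open import Algebra.Properties.Semiring.Sum +-*-semiring using (sum-cong-≗; ∑-distrib-+; ∑-comm; *-distribˡ-sum) renaming (sum to ∑)
import Data.Bool as Bool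
import Data.Nat as ℕ

-- Finite sums

ι : Bool → ℕ
ι true  = 1
ι false = 0

ι≤1 : ∀ b → ι b ≤ 1
ι≤1 true  = ≤-refl
ι≤1 false = z≤n

infix 4 _==_
_==_ : ∀ {n} → Fin n → Fin n → Bool
i == j = does (i ≟ j)

∑-cong : ∀ {n} {f g : Fin n → ℕ} → (∀ i → f i ≡ g i) → ∑ f ≡ ∑ g
∑-cong = sum-cong-≗

∑-mono : ∀ {n} {f g : Fin n → ℕ} → (∀ i → f i ≤ g i) → ∑ f ≤ ∑ g
∑-mono {zero}  h = z≤n
∑-mono {suc n} h = +-mono-≤ (h zero) (∑-mono (h ∘ suc))

∑-zero : ∀ n → ∑ {n} (λ _ → 0) ≡ 0
∑-zero zero    = refl
∑-zero (suc n) = ∑-zero n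

∑-one : ∀ n → ∑ {n} (λ _ → 1) ≡ n
∑-one zero    = refl
∑-one (suc n) = cong suc (∑-one n)

∑-scale : ∀ {n} c (f : Fin n → ℕ) → ∑ (λ i → c * f i) ≡ c * ∑ f
∑-scale c f = sym (*-distribˡ-sum c f)

∑-+ : ∀ {n} (f g : Fin n → ℕ) → ∑ (λ i → f i + g i) ≡ ∑ f + ∑ g
∑-+ = ∑-distrib-+

∑-witness : ∀ {n} {f g : Fin n → ℕ} → ∑ f < ∑ g → ∃[ i ] f i < g i
∑-witness {suc n} {f} {g} h with f zero <? g zero
... | yes p = zero , p
... | no ¬p with ∑-witness {f = f ∘ suc} {g = g ∘ suc} (+-cancelˡ-< (g zero) _ _ (≤-<-trans (+-monoˡ-≤ _ (≮⇒≥ ¬p)) h))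
...   | i , p = suc i , p

∑-positive : ∀ {n} (f : Fin n → ℕ) → 0 < ∑ f → ∃[ i ] 0 < f i
∑-positive {n} f h = ∑-witness (subst (_< ∑ f) (sym (∑-zero n)) h)

term≤∑ : ∀ {n} (f : Fin n → ℕ) i → f i ≤ ∑ f
term≤∑ f zero    = m≤m+n _ _
term≤∑ f (suc i) = m≤n⇒m≤o+n (f zero) (term≤∑ (f ∘ suc) i)

∑≡0⇒≡0 : ∀ {n} (f : Fin n → ℕ) → ∑ f ≡ 0 → ∀ i → f i ≡ 0
∑≡0⇒≡0 f eq i = n≤0⇒n≡0 (subst (f i ≤_) eq (term≤∑ f i))

∑-pick : ∀ {n} (u : Fin n) (g : Fin n → ℕ) → ∑ (λ w → ι (w == u) * g w) ≡ g u
∑-pick {suc n} zero g = trans (cong₂ _+_ (+-identityʳ (g zero)) (∑-zero n)) (+-identityʳ (g zero))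
∑-pick {suc n} (suc u) g = trans (∑-cong {n} shift) (∑-pick u (g ∘ suc))
  where
  shift : ∀ w → ι (suc w == suc u) * g (suc w) ≡ ι (w == u) * g (suc w)
  shift w with w ≟ u
  ... | yes _ = refl
  ... | no  _ = refl

two-terms≤∑ : ∀ {n} (f : Fin n → ℕ) {i j} → i ≢ j → f i + f j ≤ ∑ f
two-terms≤∑ f {i} {j} i≢j = begin
  f i + f j                                                       ≡⟨ sym (cong₂ _+_ (∑-pick i f) (∑-pick j f)) ⟩
  ∑ (λ w → ι (w == i) * f w) + ∑ (λ w → ι (w == j) * f w)         ≡⟨ sym (∑-+ (λ w → ι (w == i) * f w) (λ w → ι (w == j) * f w)) ⟩
  ∑ (λ w → ι (w == i) * f w + ι (w == j) * f w)                   ≤⟨ ∑-mono pointwise ⟩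
  ∑ f                                                             ∎
  where
  open ≤-Reasoning
  pointwise : ∀ w → ι (w == i) * f w + ι (w == j) * f w ≤ f w
  pointwise w with w ≟ i | w ≟ j
  ... | yes refl | yes refl = contradiction refl i≢j
  ... | yes _    | no _     = ≤-reflexive (trans (+-identityʳ _) (+-identityʳ _))
  ... | no _     | yes _    = ≤-reflexive (+-identityʳ _)
  ... | no _     | no _     = z≤n

-- Lets arguments by contradiction run forwards: vertices or classes are tried in turn, and either
-- one of them yields the extension `D`, or the failures together supply an estimate for all.
collect : ∀ {n} {D : Set} {P : Fin n → Set} → (∀ i → D ⊎ P i) → D ⊎ (∀ i → P i)
collect {zero}  f = inj₂ λ ()
collect {suc n} f with f zero | collect (f ∘ suc)
... | inj₁ d | _      = inj₁ d
... | inj₂ _ | inj₁ d = inj₁ d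
... | inj₂ p | inj₂ q = inj₂ λ { zero → p ; (suc i) → q i }

count≡∑ : ∀ {n} (p : Fin n → Bool) → count p ≡ ∑ (ι ∘ p)
count≡∑ {zero}  p = refl
count≡∑ {suc n} p with p zero
... | true  = cong suc (count≡∑ (p ∘ suc))
... | false = count≡∑ (p ∘ suc)

T⇒≡ : ∀ {b} → T b → b ≡ true
T⇒≡ {true} _ = refl

≡⇒T : ∀ {b} → b ≡ true → T b
≡⇒T refl = _

ι-true : ∀ {b} → 0 < ι b → b ≡ true
ι-true {true} _ = refl

-- Numerical estimates

2xy≤x²+y² : ∀ x y → 2 * (x * y) ≤ x * x + y * y
2xy≤x²+y² x y with ≤-total x y
... | inj₁ x≤y with m≤n⇒∃[o]m+o≡n x≤y
...   | z , refl = ≤-trans (m≤m+n _ (z * z)) (≤-reflexive (lem x z))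
  where
  lem : ∀ x z → 2 * (x * (x + z)) + z * z ≡ x * x + (x + z) * (x + z)
  lem = solve-∀
2xy≤x²+y² x y | inj₂ y≤x with m≤n⇒∃[o]m+o≡n y≤x
...   | z , refl = ≤-trans (m≤m+n _ (z * z)) (≤-reflexive (lem y z))
  where
  lem : ∀ y z → 2 * ((y + z) * y) + z * z ≡ (y + z) * (y + z) + y * y
  lem = solve-∀

-- (x − m)(y − m) ≥ 0
rectangle : ∀ {m x y} → m ≤ x → m ≤ y → m * (x + y) ≤ x * y + m * m
rectangle {m} m≤x m≤y with m≤n⇒∃[o]m+o≡n m≤x | m≤n⇒∃[o]m+o≡n m≤y
... | u , refl | w , refl = ≤-trans (m≤m+n _ (u * w)) (≤-reflexive (lem m u w))
  where
  lem : ∀ m u w → m * (m + u + (m + w)) + u * w ≡ (m + u) * (m + w) + m * m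
  lem = solve-∀

-- The hypothesis edges counts, per vertex of a class, the edges inside A ∪ 𝒞 when 𝒞 is cut
-- into j and k classes with an edge at every vertex for each pair of classes across the cut.
module _ {a c d : ℕ} (j k : ℕ) (j+k≡c : j + k ≡ c) (edges : j * k + a * c ≤ d * (a + c))
         (0<d : 0 < d) (c≥ : 521 * d ≤ 100 * c) where

  private
    d≤c : d ≤ c
    d≤c = *-cancelˡ-≤ 100 (≤-trans (*-monoˡ-≤ d (m≤m+n 100 421)) c≥)

  -- As `d ≤ c`, the term `a * c` absorbs `a * d`, which leaves `j * k ≤ d * c`. Two parts of at
  -- least `c / 3` have product at least `2 * c * c / 9`, so `c` would be at most 4.5 `d`, against
  -- 5.21 `d`.
  no-middle-cut : c ≤ 3 * j → c ≤ 3 * k → ⊥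
  no-middle-cut c≤3j c≤3k = <⇒≱ gap (begin
    1042 * (d * c)        ≡⟨ l₁ d c ⟩
    2 * ((521 * d) * c)   ≤⟨ *-monoʳ-≤ 2 (*-monoˡ-≤ c c≥) ⟩
    2 * ((100 * c) * c)   ≡⟨ l₂ c ⟩
    100 * (2 * (c * c))   ≤⟨ *-monoʳ-≤ 100 2cc≤9jk ⟩
    100 * (9 * (j * k))   ≤⟨ *-monoʳ-≤ 100 (*-monoʳ-≤ 9 jk≤dc) ⟩
    100 * (9 * (d * c))   ≡⟨ l₃ d c ⟩
    900 * (d * c)         ∎)
    where
    open ≤-Reasoning
    l₁ : ∀ d c → 1042 * (d * c) ≡ 2 * ((521 * d) * c)
    l₁ = solve-∀
    l₂ : ∀ c → 2 * ((100 * c) * c) ≡ 100 * (2 * (c * c))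
    l₂ = solve-∀
    l₃ : ∀ d c → 100 * (9 * (d * c)) ≡ 900 * (d * c)
    l₃ = solve-∀
    instance
      dc≢0 : NonZero (d * c)
      dc≢0 = >-nonZero (*-mono-≤ 0<d (≤-trans 0<d d≤c))
    gap : 900 * (d * c) < 1042 * (d * c)
    gap = *-monoˡ-< (d * c) (m≤m+n 901 141)
    jk≤dc : j * k ≤ d * c
    jk≤dc = +-cancelʳ-≤ (a * c) _ _ (begin
      j * k + a * c     ≤⟨ edges ⟩
      d * (a + c)       ≡⟨ l d a c ⟩
      d * c + a * d     ≤⟨ +-monoʳ-≤ (d * c) (*-monoʳ-≤ a d≤c) ⟩
      d * c + a * c     ∎)
      where
      l : ∀ d a c → d * (a + c) ≡ d * c + a * d
      l = solve-∀
    2cc≤9jk : 2 * (c * c) ≤ 9 * (j * k)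
    2cc≤9jk = +-cancelʳ-≤ (c * c) _ _ (begin
      2 * (c * c) + c * c               ≡⟨ l c ⟩
      c * (3 * c)                       ≡⟨ cong (λ t → c * (3 * t)) (sym j+k≡c) ⟩
      c * (3 * (j + k))                 ≡⟨ cong (c *_) (*-distribˡ-+ 3 j k) ⟩
      c * (3 * j + 3 * k)               ≤⟨ rectangle c≤3j c≤3k ⟩
      3 * j * (3 * k) + c * c           ≡⟨ cong (_+ c * c) (l′ j k) ⟩
      9 * (j * k) + c * c               ∎)
      where
      l : ∀ c → 2 * (c * c) + c * c ≡ c * (3 * c)
      l = solve-∀
      l′ : ∀ j k → 3 * j * (3 * k) ≡ 9 * (j * k)
      l′ = solve-∀

  -- Write `d = a + f`, so that `14 * d - 11 * a` is `μ`. If `10 * j` exceeds `μ`, then, as `10 * k`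
  -- does not fall below it either, `100 * (j * k)` is at least `μ * (10 * c - μ)`, more than
  -- `edges` permits.
  small-cut-bound : a ≤ d → 3 * j < c → 10 * j + 11 * a ≤ 14 * d
  small-cut-bound a≤d 3j<c with 10 * j + 11 * a ≤? 14 * d | m≤n⇒∃[o]m+o≡n a≤d
  ... | yes le | _        = le
  ... | no ¬le | f , refl = contradiction (begin
      suc (10000 * (a * (a + f)) + 100 * (μ * μ))
        -- The three coefficients are the difference of the two sides after `(a + f) * (a + f)` has
        -- been split off. That square is at least 1 because `0 < d`, which makes the contradiction
        -- strict.
        ≤⟨ s≤s (m≤m+n _ (4729 * (a * a) + 18068 * (a * f) + 1239 * (f * f))) ⟩
      1 + (10000 * (a * (a + f)) + 100 * (μ * μ) + (4729 * (a * a) + 18068 * (a * f) + 1239 * (f * f)))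
        ≤⟨ +-monoˡ-≤ _ (*-mono-≤ 0<d 0<d) ⟩
      (a + f) * (a + f) + (10000 * (a * (a + f)) + 100 * (μ * μ) + (4729 * (a * a) + 18068 * (a * f) + 1239 * (f * f)))
        ≡⟨ l₁ a f ⟩
      (30 * a + 40 * f) * (521 * (a + f))
        ≤⟨ *-monoʳ-≤ (30 * a + 40 * f) c≥ ⟩
      (30 * a + 40 * f) * (100 * c)
        ≡⟨ l₂ a f c ⟩
      100 * ((30 * a + 40 * f) * c)
        ≤⟨ *-monoʳ-≤ 100 reduced ⟩
      100 * (100 * (a * (a + f)) + μ * μ)
        ≡⟨ l₃ (a * (a + f)) (μ * μ) ⟩
      10000 * (a * (a + f)) + 100 * (μ * μ) ∎) (<⇒≱ (n<1+n _))
    where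
    open ≤-Reasoning
    μ = 3 * a + 14 * f
    l₁ : ∀ a f → (a + f) * (a + f) + (10000 * (a * (a + f)) + 100 * ((3 * a + 14 * f) * (3 * a + 14 * f)) + (4729 * (a * a) + 18068 * (a * f) + 1239 * (f * f))) ≡ (30 * a + 40 * f) * (521 * (a + f))
    l₁ = solve-∀
    l₂ : ∀ a f c → (30 * a + 40 * f) * (100 * c) ≡ 100 * ((30 * a + 40 * f) * c)
    l₂ = solve-∀
    l₃ : ∀ x y → 100 * (100 * x + y) ≡ 10000 * x + 100 * y
    l₃ = solve-∀
    l₄ : ∀ a f → 3 * a + 14 * f + 11 * a ≡ 14 * (a + f)
    l₄ = solve-∀
    μ≤10j : μ ≤ 10 * j
    μ≤10j = +-cancelʳ-≤ (11 * a) _ _ (≤-trans (≤-reflexive (l₄ a f)) (<⇒≤ (≰⇒> ¬le)))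
    2c≤3k : 2 * c ≤ 3 * k
    2c≤3k = +-cancelˡ-≤ (3 * j) _ _ (begin
      3 * j + 2 * c     ≤⟨ +-monoˡ-≤ (2 * c) (<⇒≤ 3j<c) ⟩
      3 * c             ≡⟨ cong (3 *_) (sym j+k≡c) ⟩
      3 * (j + k)       ≡⟨ *-distribˡ-+ 3 j k ⟩
      3 * j + 3 * k     ∎)
    μ≤10k : μ ≤ 10 * k
    μ≤10k = *-cancelˡ-≤ 15 (begin
      15 * μ                        ≤⟨ m≤m+n _ (476 * a + 311 * f) ⟩
      15 * μ + (476 * a + 311 * f)  ≡⟨ l a f ⟩
      521 * (a + f)                 ≤⟨ c≥ ⟩
      100 * c                       ≡⟨ *-assoc 50 2 c ⟩
      50 * (2 * c)                  ≤⟨ *-monoʳ-≤ 50 2c≤3k ⟩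
      50 * (3 * k)                  ≡⟨ l′ k ⟩
      15 * (10 * k)                 ∎)
      where
      l : ∀ a f → 15 * (3 * a + 14 * f) + (476 * a + 311 * f) ≡ 521 * (a + f)
      l = solve-∀
      l′ : ∀ k → 50 * (3 * k) ≡ 15 * (10 * k)
      l′ = solve-∀
    reduced : (30 * a + 40 * f) * c ≤ 100 * (a * (a + f)) + μ * μ
    reduced = +-cancelʳ-≤ (100 * (a * c) + 100 * (f * c)) _ _ (begin
      (30 * a + 40 * f) * c + (100 * (a * c) + 100 * (f * c))  ≡⟨ l a f c ⟩
      μ * (10 * c) + 100 * (a * c)                             ≡⟨ cong (λ t → μ * (10 * t) + 100 * (a * c)) (sym j+k≡c) ⟩
      μ * (10 * (j + k)) + 100 * (a * c)                       ≡⟨ cong (λ t → μ * t + 100 * (a * c)) (*-distribˡ-+ 10 j k) ⟩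
      μ * (10 * j + 10 * k) + 100 * (a * c)                    ≤⟨ +-monoˡ-≤ _ (rectangle μ≤10j μ≤10k) ⟩
      10 * j * (10 * k) + μ * μ + 100 * (a * c)                ≡⟨ l′ j k (μ * μ) (a * c) ⟩
      100 * (j * k + a * c) + μ * μ                            ≤⟨ +-monoˡ-≤ _ (*-monoʳ-≤ 100 edges) ⟩
      100 * ((a + f) * (a + c)) + μ * μ                        ≡⟨ l″ a f c (μ * μ) ⟩
      100 * (a * (a + f)) + μ * μ + (100 * (a * c) + 100 * (f * c)) ∎)
      where
      l : ∀ a f c → (30 * a + 40 * f) * c + (100 * (a * c) + 100 * (f * c)) ≡ (3 * a + 14 * f) * (10 * c) + 100 * (a * c)
      l = solve-∀
      l′ : ∀ j k m x → 10 * j * (10 * k) + m + 100 * x ≡ 100 * (j * k + x) + m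
      l′ = solve-∀
      l″ : ∀ a f c m → 100 * ((a + f) * (a + c)) + m ≡ 100 * (a * (a + f)) + m + (100 * (a * c) + 100 * (f * c))
      l″ = solve-∀

-- Ensures that the truncated subtraction defining `N` in `extend-blocked` is exact; `1 ≤ a` pays
-- for the constant 10.
weight-exists : ∀ {a d r} → 1 ≤ a → 621 * d ≤ 100 * r → 34 * d + 10 ≤ 10 * r + 11 * a
weight-exists {a} {d} {r} 1≤a r≥ = *-cancelˡ-≤ 10 (begin
  10 * (34 * d + 10)         ≡⟨ l d ⟩
  340 * d + 100 * 1          ≤⟨ +-mono-≤ (*-monoˡ-≤ d (m≤m+n 340 281)) (*-mono-≤ (m≤m+n 100 10) 1≤a) ⟩
  621 * d + 110 * a          ≤⟨ +-monoˡ-≤ (110 * a) r≥ ⟩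
  100 * r + 110 * a          ≡⟨ l′ r a ⟩
  10 * (10 * r + 11 * a)     ∎)
  where
  open ≤-Reasoning
  l : ∀ d → 10 * (34 * d + 10) ≡ 340 * d + 100
  l = solve-∀
  l′ : ∀ r a → 100 * r + 110 * a ≡ 10 * (10 * r + 11 * a)
  l′ = solve-∀

-- With κ = r − d − (14d − 11a)/10, the lower bound for the part of 𝒞 that is reachable,
-- N = 10 (κ − d − 1) and D = N + 10a: this ratio makes few-solo-bound tight for k = κ.
module Weights {a d r N : ℕ} (N-def : N + (34 * d + 10) ≡ 10 * r + 11 * a)
               (1≤a : 1 ≤ a) (r≥ : 621 * d ≤ 100 * r) where

  D = N + 10 * a

  private
    open ≤-Reasoning

    core : ∀ k → 10 * r + 11 * a ≤ 10 * k + 24 * d → N + (10 * d + 10) ≤ 10 * k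
    core k h = +-cancelʳ-≤ (24 * d) _ _ (begin
      N + (10 * d + 10) + 24 * d  ≡⟨ l N d ⟩
      N + (34 * d + 10)           ≡⟨ N-def ⟩
      10 * r + 11 * a             ≤⟨ h ⟩
      10 * k + 24 * d             ∎)
      where
      l : ∀ N d → N + (10 * d + 10) + 24 * d ≡ N + (34 * d + 10)
      l = solve-∀

    N+10-large : 281 * d + 110 * a ≤ 10 * N + 100
    N+10-large = +-cancelʳ-≤ (340 * d) _ _ (begin
      281 * d + 110 * a + 340 * d  ≡⟨ l d a ⟩
      621 * d + 110 * a            ≤⟨ +-monoˡ-≤ _ r≥ ⟩
      100 * r + 110 * a            ≡⟨ l′ r a ⟩
      10 * (10 * r + 11 * a)       ≡⟨ cong (10 *_) (sym N-def) ⟩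
      10 * (N + (34 * d + 10))     ≡⟨ l″ N d ⟩
      10 * N + 100 + 340 * d       ∎)
      where
      l : ∀ d a → 281 * d + 110 * a + 340 * d ≡ 621 * d + 110 * a
      l = solve-∀
      l′ : ∀ r a → 100 * r + 110 * a ≡ 10 * (10 * r + 11 * a)
      l′ = solve-∀
      l″ : ∀ N d → 10 * (N + (34 * d + 10)) ≡ 10 * N + 100 + 340 * d
      l″ = solve-∀

    N-large : 281 * d + 10 * a ≤ 10 * N
    N-large = +-cancelʳ-≤ (100 * a) _ _ (begin
      281 * d + 10 * a + 100 * a  ≡⟨ l d a ⟩
      281 * d + 110 * a           ≤⟨ N+10-large ⟩
      10 * N + 100                ≤⟨ +-monoʳ-≤ (10 * N) (*-monoʳ-≤ 100 1≤a) ⟩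
      10 * N + 100 * a            ∎)
      where
      l : ∀ d a → 281 * d + 10 * a + 100 * a ≡ 281 * d + 110 * a
      l = solve-∀

    -- `N+10-large` bounds one factor of `N * N` from below; once `24 * (d * N)` is cancelled,
    -- `N-large` bounds the other factor of what is left. A positive definite form in `a` and `d`
    -- remains.
    quadratic : 24 * (d * N) + 720 * (a * d) ≤ N * N + a * N + 330 * (a * a) + 10 * N + 100 * a
    quadratic = *-cancelˡ-≤ 100 (begin
      100 * (24 * (d * N) + 720 * (a * d))
        ≤⟨ m≤m+n _ (1506 * (a * d)) ⟩
      100 * (24 * (d * N) + 720 * (a * d)) + 1506 * (a * d)
        ≡⟨ l₁ a d N ⟩
      -- 107 and 184 are the integer parts of the square roots of 11521 = 281 · 41 and 34200 = 10 ·
      -- 120 + 33000, the coefficients of `d * d` and `a * a` in that form.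
      240 * d * (10 * N) + 34130 * (a * d) + 2 * ((107 * d) * (184 * a))
        ≤⟨ +-monoʳ-≤ (240 * d * (10 * N) + 34130 * (a * d)) (2xy≤x²+y² (107 * d) (184 * a)) ⟩
      240 * d * (10 * N) + 34130 * (a * d) + ((107 * d) * (107 * d) + (184 * a) * (184 * a))
        ≤⟨ m≤m+n _ (72 * (d * d) + 344 * (a * a) + 10000 * a) ⟩
      240 * d * (10 * N) + 34130 * (a * d) + ((107 * d) * (107 * d) + (184 * a) * (184 * a)) + (72 * (d * d) + 344 * (a * a) + 10000 * a)
        ≡⟨ l₂ a d N ⟩
      (281 * d + 10 * a) * (41 * d + 120 * a) + (240 * d * (10 * N) + 33000 * (a * a) + 10000 * a)
        ≤⟨ +-monoˡ-≤ _ (*-monoˡ-≤ (41 * d + 120 * a) N-large) ⟩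
      10 * N * (41 * d + 120 * a) + (240 * d * (10 * N) + 33000 * (a * a) + 10000 * a)
        ≡⟨ l₃ a d N ⟩
      10 * N * (281 * d + 110 * a) + (10 * N * (10 * a) + 33000 * (a * a) + 10000 * a)
        ≤⟨ +-monoˡ-≤ _ (*-monoʳ-≤ (10 * N) N+10-large) ⟩
      10 * N * (10 * N + 100) + (10 * N * (10 * a) + 33000 * (a * a) + 10000 * a)
        ≡⟨ l₄ a N ⟩
      100 * (N * N + a * N + 330 * (a * a) + 10 * N + 100 * a) ∎)
      where
      l₁ : ∀ a d N → 100 * (24 * (d * N) + 720 * (a * d)) + 1506 * (a * d) ≡ 240 * d * (10 * N) + 34130 * (a * d) + 2 * ((107 * d) * (184 * a))
      l₁ = solve-∀
      l₂ : ∀ a d N → 240 * d * (10 * N) + 34130 * (a * d) + ((107 * d) * (107 * d) + (184 * a) * (184 * a)) + (72 * (d * d) + 344 * (a * a) + 10000 * a) ≡ (281 * d + 10 * a) * (41 * d + 120 * a) + (240 * d * (10 * N) + 33000 * (a * a) + 10000 * a)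
      l₂ = solve-∀
      l₃ : ∀ a d N → 10 * N * (41 * d + 120 * a) + (240 * d * (10 * N) + 33000 * (a * a) + 10000 * a) ≡ 10 * N * (281 * d + 110 * a) + (10 * N * (10 * a) + 33000 * (a * a) + 10000 * a)
      l₃ = solve-∀
      l₄ : ∀ a N → 10 * N * (10 * N + 100) + (10 * N * (10 * a) + 33000 * (a * a) + 10000 * a) ≡ 100 * (N * N + a * N + 330 * (a * a) + 10 * N + 100 * a)
      l₄ = solve-∀

  10a≤N : a ≤ d → 10 * a ≤ N
  10a≤N a≤d = *-cancelˡ-≤ 10 (begin
    10 * (10 * a)      ≡⟨ sym (*-assoc 10 10 a) ⟩
    100 * a            ≤⟨ *-monoʳ-≤ 100 a≤d ⟩
    100 * d            ≤⟨ *-monoˡ-≤ d (m≤m+n 100 181) ⟩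
    281 * d            ≤⟨ m≤m+n (281 * d) (10 * a) ⟩
    281 * d + 10 * a   ≤⟨ N-large ⟩
    10 * N             ∎)

  -- With `r = k + o + a` the terms `N * k` and `N * o` cancel, and what is left is `2 * a` times
  -- `core`.
  few-solo-bound : ∀ {k o} → k + o + a ≡ r → 10 * r + 11 * a ≤ 10 * k + 24 * d →
                   2 * N * r + 20 * a * suc d ≤ 2 * D * k + 2 * N * o
  few-solo-bound {k} {o} refl hk = begin
    2 * N * (k + o + a) + 20 * a * suc d            ≡⟨ l N k o a d ⟩
    2 * N * (k + o) + 2 * a * (N + (10 * d + 10))   ≤⟨ +-monoʳ-≤ (2 * N * (k + o)) (*-monoʳ-≤ (2 * a) (core k hk)) ⟩
    2 * N * (k + o) + 2 * a * (10 * k)              ≡⟨ l′ N k o a ⟩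
    2 * D * k + 2 * N * o                           ∎
    where
    l : ∀ N k o a d → 2 * N * (k + o + a) + 20 * a * (1 + d) ≡ 2 * N * (k + o) + 2 * a * (N + (10 * d + 10))
    l = solve-∀
    l′ : ∀ N k o a → 2 * N * (k + o) + 2 * a * (10 * k) ≡ 2 * (N + 10 * a) * k + 2 * N * o
    l′ = solve-∀

  -- Since `k + o = r - a` is fixed, the right side increases with `g` and with `k`. Putting both at
  -- their lower bound reduces the claim to `quadratic`. The summand `33 * (a * D) + 22 * (a * N)`
  -- completes the multiples of `r` to multiples of `10 * r + 11 * a`, which `N-def` eliminates.
  many-hits-bound : ∀ {g k o} → k + o + a ≡ r → 10 * r + 11 * a ≤ 10 * k + 24 * d →
                    10 * r + 11 * a ≤ 10 * g + 24 * d →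
                    D * (3 * r + d) ≤ 2 * D * g + (2 * D * k + 2 * N * o)
  many-hits-bound {g} {k} {o} refl hk hg = *-cancelˡ-≤ 10 (+-cancelʳ-≤ (33 * (a * D) + 22 * (a * N)) _ _ (begin
    10 * (D * (3 * r + d)) + (33 * (a * D) + 22 * (a * N))
      ≡⟨ l₁ a d r N ⟩
    3 * D * (10 * r + 11 * a) + (10 * (d * D) + 22 * (a * N))
      ≡⟨ cong (λ t → 3 * D * t + (10 * (d * D) + 22 * (a * N))) (sym N-def) ⟩
    3 * D * (N + (34 * d + 10)) + (10 * (d * D) + 22 * (a * N))
      ≤⟨ +-cancelʳ-≤ small _ _ (≤-trans (+-monoʳ-≤ (3 * D * (N + (34 * d + 10)) + (10 * (d * D) + 22 * (a * N))) quadratic) (≤-reflexive (l₂ a d N))) ⟩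
    2 * D * κ + 2 * N * (N + (34 * d + 10)) + 20 * a * (10 * d + 10) + 33 * (a * D)
      ≡⟨ cong (λ t → 2 * D * κ + 2 * N * t + 20 * a * (10 * d + 10) + 33 * (a * D)) N-def ⟩
    2 * D * κ + 2 * N * (10 * r + 11 * a) + 20 * a * (10 * d + 10) + 33 * (a * D)
      ≡⟨ l₃ a d N k o ⟩
    2 * D * κ + 20 * a * κ + (20 * N * (k + o) + (33 * (a * D) + 22 * (a * N)))
      ≤⟨ +-monoˡ-≤ _ (+-mono-≤ (*-monoʳ-≤ (2 * D) (core g hg)) (*-monoʳ-≤ (20 * a) (core k hk))) ⟩
    2 * D * (10 * g) + 20 * a * (10 * k) + (20 * N * (k + o) + (33 * (a * D) + 22 * (a * N)))
      ≡⟨ l₄ a N g k o ⟩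
    10 * (2 * D * g + (2 * D * k + 2 * N * o)) + (33 * (a * D) + 22 * (a * N)) ∎))
    where
    -- This is ten times the rational bound κ from which `N` is defined.
    κ = N + (10 * d + 10)
    small = 24 * (d * N) + 720 * (a * d)
    l₁ : ∀ a d r N → 10 * ((N + 10 * a) * (3 * r + d)) + (33 * (a * (N + 10 * a)) + 22 * (a * N)) ≡ 3 * (N + 10 * a) * (10 * r + 11 * a) + (10 * (d * (N + 10 * a)) + 22 * (a * N))
    l₁ = solve-∀
    l₂ : ∀ a d N → 3 * (N + 10 * a) * (N + (34 * d + 10)) + (10 * (d * (N + 10 * a)) + 22 * (a * N)) + (N * N + a * N + 330 * (a * a) + 10 * N + 100 * a) ≡ 2 * (N + 10 * a) * (N + (10 * d + 10)) + 2 * N * (N + (34 * d + 10)) + 20 * a * (10 * d + 10) + 33 * (a * (N + 10 * a)) + (24 * (d * N) + 720 * (a * d))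
    l₂ = solve-∀
    l₃ : ∀ a d N k o → 2 * (N + 10 * a) * (N + (10 * d + 10)) + 2 * N * (10 * (k + o + a) + 11 * a) + 20 * a * (10 * d + 10) + 33 * (a * (N + 10 * a)) ≡ 2 * (N + 10 * a) * (N + (10 * d + 10)) + 20 * a * (N + (10 * d + 10)) + (20 * N * (k + o) + (33 * (a * (N + 10 * a)) + 22 * (a * N)))
    l₃ = solve-∀
    l₄ : ∀ a N g k o → 2 * (N + 10 * a) * (10 * g) + 20 * a * (10 * k) + (20 * N * (k + o) + (33 * (a * (N + 10 * a)) + 22 * (a * N))) ≡ 10 * (2 * (N + 10 * a) * g + (2 * (N + 10 * a) * k + 2 * N * o)) + (33 * (a * (N + 10 * a)) + 22 * (a * N))
    l₄ = solve-∀

-- Degenerate graphs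

module Sparse {n d : ℕ} (G : Graph n) (degenerate : Degenerate d G) where

  induced : (Q : Fin n → Bool) → Subgraph G
  induced Q = record
    { vert  = Q
    ; edge  = λ u w → Q u ∧ (Q w ∧ adj G u w)
    ; esym  = λ u w → trans (swap (Q u) (Q w) (adj G u w)) (cong (λ b → Q w ∧ (Q u ∧ b)) (Graph.sym G u w))
    ; eadj  = λ u w → third (Q u) (Q w)
    ; evert = λ u w → first (Q u) (Q w)
    }
    where
    swap : ∀ a b c → a ∧ (b ∧ c) ≡ b ∧ (a ∧ c)
    swap true  true  c = refl
    swap true  false c = refl
    swap false true  c = refl
    swap false false c = refl
    third : ∀ a b {c} → T (a ∧ (b ∧ c)) → T c
    third true true t = t
    first : ∀ a b {c} → T (a ∧ (b ∧ c)) → T a × T b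
    first true true t = _ , _

  low-degree : ∀ Q {u} → Q u ≡ true → ∃[ v ] Q v ≡ true × ∑ (λ w → ι (Q w) * ι (adj G v w)) ≤ d
  low-degree Q {u} Qu with degenerate (induced Q) (u , ≡⇒T Qu)
  ... | v , Tv , deg≤d = v , Qv , ≤-trans (≤-reflexive (sym (trans (count≡∑ (λ w → Q v ∧ (Q w ∧ adj G v w))) (∑-cong pointwise)))) deg≤d
    where
    Qv = T⇒≡ Tv
    pointwise : ∀ w → ι (Q v ∧ (Q w ∧ adj G v w)) ≡ ι (Q w) * ι (adj G v w)
    pointwise w rewrite Qv with Q w
    ... | true  = sym (+-identityʳ _)
    ... | false = refl

  _∖_ : (Fin n → Bool) → Fin n → Fin n → Bool
  (Q ∖ v) w = Q w ∧ not (w == v)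

  ι-∖ : ∀ Q {v} → Q v ≡ true → ∀ w → ι (Q w) ≡ ι (w == v) + ι ((Q ∖ v) w)
  ι-∖ Q {v} Qv w with w ≟ v
  ... | yes refl rewrite Qv = refl
  ... | no _ with Q w
  ...   | true  = refl
  ...   | false = refl

  size-∖ : ∀ Q {v} → Q v ≡ true → ∑ (ι ∘ Q) ≡ suc (∑ (ι ∘ (Q ∖ v)))
  size-∖ Q {v} Qv = trans (∑-cong (ι-∖ Q Qv)) (trans (∑-+ (λ w → ι (w == v)) _)
    (cong (_+ ∑ (ι ∘ (Q ∖ v))) (trans (∑-cong {n} λ w → sym (*-identityʳ _)) (∑-pick v (λ _ → 1)))))

  -- Ordered pairs are counted, so an edge within one set counts twice. Weights in place of sets
  -- make the count additive in each argument.
  edgesIn : (Fin n → ℕ) → (Fin n → ℕ) → ℕ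
  edgesIn f g = ∑ λ u → ∑ λ w → f u * g w * ι (adj G u w)

  edgesIn-sym : ∀ f g → edgesIn f g ≡ edgesIn g f
  edgesIn-sym f g = trans (∑-comm (λ u w → f u * g w * ι (adj G u w))) (∑-cong λ w → ∑-cong λ u →
    cong₂ _*_ (*-comm (f u) (g w)) (cong ι (Graph.sym G u w)))

  edgesIn-+ : ∀ f₁ f₂ g → edgesIn (λ u → f₁ u + f₂ u) g ≡ edgesIn f₁ g + edgesIn f₂ g
  edgesIn-+ f₁ f₂ g = trans (∑-cong λ u → trans (∑-cong λ w → l (f₁ u) (f₂ u) (g w) (ι (adj G u w))) (∑-+ (λ w → f₁ u * g w * ι (adj G u w)) (λ w → f₂ u * g w * ι (adj G u w))))
    (∑-+ (λ u → ∑ λ w → f₁ u * g w * ι (adj G u w)) (λ u → ∑ λ w → f₂ u * g w * ι (adj G u w)))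
    where
    l : ∀ a b c e → (a + b) * c * e ≡ a * c * e + b * c * e
    l = solve-∀

  edgesIn-mono : ∀ {f f′ g g′} → (∀ u → f u ≤ f′ u) → (∀ u → g u ≤ g′ u) → edgesIn f g ≤ edgesIn f′ g′
  edgesIn-mono p q = ∑-mono λ u → ∑-mono λ w → *-monoˡ-≤ (ι (adj G u w)) (*-mono-≤ (p u) (q w))

  edgesIn-pick : ∀ v g → edgesIn (λ u → ι (u == v)) g ≡ ∑ (λ w → g w * ι (adj G v w))
  edgesIn-pick v g = trans (∑-cong λ u → trans (∑-cong λ w → *-assoc (ι (u == v)) (g w) (ι (adj G u w)))
      (∑-scale (ι (u == v)) (λ w → g w * ι (adj G u w))))
    (∑-pick v (λ u → ∑ λ w → g w * ι (adj G u w)))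

  -- Deleting a vertex of degree at most `d` within `Q` destroys at most `d` edges, each counted in
  -- both directions.
  sparse : ∀ k Q → ∑ (ι ∘ Q) ≡ k → edgesIn (ι ∘ Q) (ι ∘ Q) ≤ 2 * d * k
  sparse k Q eq with 0 <? ∑ (ι ∘ Q)
  sparse k Q eq | no ¬p = ≤-trans (≤-reflexive (trans (∑-cong λ u → trans (∑-cong λ w → cong (λ b → b * ι (Q w) * ι (adj G u w)) (empty u)) (∑-zero n)) (∑-zero n))) z≤n
    where
    empty : ∀ u → ι (Q u) ≡ 0
    empty = ∑≡0⇒≡0 (ι ∘ Q) (n≤0⇒n≡0 (≮⇒≥ ¬p))
  sparse zero Q eq | yes p = contradiction p (<⇒≱ (s≤s (≤-reflexive eq)))
  sparse (suc k) Q eq | yes p with ∑-positive (ι ∘ Q) p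
  ... | u , pu with low-degree Q (ι-true pu)
  ... | v , Qv , deg≤d = begin
      edgesIn q q                             ≤⟨ edgesIn-mono (≤-reflexive ∘ ι-∖ Q Qv) (λ _ → ≤-refl) ⟩
      edgesIn (λ u → e u + q′ u) q            ≡⟨ edgesIn-+ e q′ q ⟩
      edgesIn e q + edgesIn q′ q              ≡⟨ cong (edgesIn e q +_) (edgesIn-sym q′ q) ⟩
      edgesIn e q + edgesIn q q′              ≤⟨ +-monoʳ-≤ (edgesIn e q) (edgesIn-mono (≤-reflexive ∘ ι-∖ Q Qv) (λ _ → ≤-refl)) ⟩
      edgesIn e q + edgesIn (λ u → e u + q′ u) q′  ≡⟨ cong (edgesIn e q +_) (edgesIn-+ e q′ q′) ⟩
      edgesIn e q + (edgesIn e q′ + edgesIn q′ q′) ≤⟨ +-mono-≤ star (+-mono-≤ (≤-trans (edgesIn-mono (λ u → ≤-refl {e u}) q′≤q) star) (sparse k (Q ∖ v) (suc-injective (trans (sym (size-∖ Q Qv)) eq)))) ⟩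
      d + (d + 2 * d * k)                     ≡⟨ l d k ⟩
      2 * d * suc k                           ∎
    where
    open ≤-Reasoning
    q q′ e : Fin n → ℕ
    q = ι ∘ Q
    q′ = ι ∘ (Q ∖ v)
    e u = ι (u == v)
    q′≤q : ∀ w → q′ w ≤ q w
    q′≤q w = ≤-trans (m≤n+m (q′ w) (e w)) (≤-reflexive (sym (ι-∖ Q Qv w)))
    star : edgesIn e q ≤ d
    star = ≤-trans (≤-reflexive (edgesIn-pick v q)) deg≤d
    l : ∀ d k → d + (d + 2 * d * k) ≡ 2 * d * (1 + k)
    l = solve-∀

  -- A vertex of degree at most `d` within `Q` accounts, together with its neighbours there, for at
  -- most `d + 1` vertices of `Q`.
  nonadjacent-pair : ∀ Q → suc d < ∑ (ι ∘ Q) →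
    ∃[ x ] ∃[ y ] Q x ≡ true × Q y ≡ true × x ≢ y × adj G x y ≡ false
  nonadjacent-pair Q big with ∑-positive (ι ∘ Q) (≤-trans (s≤s z≤n) big)
  ... | u , pu with low-degree Q (ι-true pu)
  ... | v , Qv , deg≤d with ∑-witness (≤-<-trans bound big)
    where
    bound : ∑ (λ w → ι (w == v) * 1 + ι (Q w) * ι (adj G v w)) ≤ suc d
    bound = ≤-trans (≤-reflexive (trans (∑-+ (λ w → ι (w == v) * 1) _) (cong (_+ ∑ (λ w → ι (Q w) * ι (adj G v w))) (∑-pick v (λ _ → 1))))) (s≤s deg≤d)
  ... | w , lt with w ≟ v | Q w in Qw | adj G v w in vw
  ...   | yes _ | true  | _     = contradiction lt (<⇒≱ (s≤s (s≤s z≤n)))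
  ...   | no ne | true  | false = v , w , Qv , Qw , (λ eq → ne (sym eq)) , vw
  ...   | no ne | true  | true  = contradiction lt (<⇒≱ ≤-refl)

  -- If `U` has only `d + 1` elements, a vertex `s` of `S` outside `U` is added to it. A nonadjacent
  -- pair in the enlarged set still has an end in `U`.
  nonadjacent-pair-in : ∀ U S → (∀ w → U w ≡ true → S w ≡ true) → d < ∑ (ι ∘ U) → suc d < ∑ (ι ∘ S) →
    ∃[ x ] ∃[ y ] U x ≡ true × S y ≡ true × x ≢ y × adj G x y ≡ false
  nonadjacent-pair-in U S U⊆S bigU bigS with suc d <? ∑ (ι ∘ U)
  ... | yes p with nonadjacent-pair U p
  ...   | x , y , Ux , Uy , rest = x , y , Ux , U⊆S y Uy , rest
  nonadjacent-pair-in U S U⊆S bigU bigS | no ¬p with ∑-witness (≤-<-trans (≮⇒≥ ¬p) bigS)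
  ... | s , lt with U s in Us | S s in Ss
  ...   | false | true = finish (nonadjacent-pair Q (≤-trans (s≤s bigU) (≤-reflexive (sym size-Q))))
    where
    Q : Fin n → Bool
    Q w = if w == s then true else U w
    Qs : Q s ≡ true
    Qs rewrite dec-true (s ≟ s) refl = refl
    same : ∀ w → ι ((Q ∖ s) w) ≡ ι (U w)
    same w with w ≟ s
    ... | yes refl rewrite Us = refl
    ... | no _ with U w
    ...   | true  = refl
    ...   | false = refl
    size-Q : ∑ (ι ∘ Q) ≡ suc (∑ (ι ∘ U))
    size-Q = trans (size-∖ Q Qs) (cong suc (∑-cong same))
    finish : ∃[ x ] ∃[ y ] Q x ≡ true × Q y ≡ true × x ≢ y × adj G x y ≡ false →
             ∃[ x ] ∃[ y ] U x ≡ true × S y ≡ true × x ≢ y × adj G x y ≡ false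
    finish (x , y , Qx , Qy , x≢y , xy) with x ≟ s | y ≟ s
    ... | yes refl | yes refl = contradiction refl x≢y
    ... | yes refl | no _     = y , x , Qy , Ss , (λ eq → x≢y (sym eq)) , trans (Graph.sym G y x) xy
    ... | no _     | yes refl = x , y , Qx , Ss , x≢y , xy
    ... | no _     | no _     = x , y , Qx , U⊆S y Qy , x≢y , xy
  nonadjacent-pair-in U S U⊆S bigU bigS | no ¬p | s , s≤s () | true | true

-- Partial colourings

==-refl : ∀ {n} (i : Fin n) → (i == i) ≡ true
==-refl i = dec-true (i ≟ i) refl

true≢false : ∀ {b} → b ≡ true → b ≡ false → ⊥
true≢false refl ()

∧-true : ∀ {a b} → a ∧ b ≡ true → a ≡ true × b ≡ true
∧-true {true} {true} _ = refl , refl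

true-∧ : ∀ {a b} → a ≡ true → b ≡ true → a ∧ b ≡ true
true-∧ refl refl = refl

_∋_ : ∀ {r} → (Fin r → Bool) → Maybe (Fin r) → Bool
S ∋ nothing = false
S ∋ just i  = S i

δ : ∀ {r} → Fin r → Maybe (Fin r) → ℕ
δ i m = ι ((i ==_) ∋ m)

δ-refl : ∀ {r} (i : Fin r) → δ i (just i) ≡ 1
δ-refl i = cong ι (==-refl i)

δ-positive : ∀ {r} {i : Fin r} m → 0 < δ i m → m ≡ just i
δ-positive {i = i} (just j) p with i ≟ j
... | yes refl = refl

∋-positive : ∀ {r} (S : Fin r → Bool) m → S ∋ m ≡ true → ∃[ i ] m ≡ just i × S i ≡ true
∋-positive S (just i) p = i , refl , p

uncoloured : ∀ {r} {m : Maybe (Fin r)} → is-just m ≡ false → m ≡ nothing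
uncoloured {m = nothing} _ = refl

∑-δ : ∀ {r} (S : Fin r → Bool) m → ∑ (λ i → ι (S i) * δ i m) ≡ ι (S ∋ m)
∑-δ {r} S nothing  = trans (∑-cong λ i → *-zeroʳ (ι (S i))) (∑-zero r)
∑-δ S (just j) = trans (∑-cong λ i → *-comm (ι (S i)) (ι (i == j))) (∑-pick j (ι ∘ S))

card : ∀ {r} → (Fin r → Bool) → ℕ
card S = ∑ (ι ∘ S)

module Colourings {n : ℕ} (G : Graph n) (r : ℕ) where

  Colouring : Set
  Colouring = Fin n → Maybe (Fin r)

  Proper : Colouring → Set
  Proper c = ∀ {u w i} → adj G u w ≡ true → c u ≡ just i → c w ≡ just i → ⊥

  size : Colouring → Fin r → ℕ
  size c i = ∑ λ u → δ i (c u)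

  nbrs : Colouring → Fin n → Fin r → ℕ
  nbrs c x i = ∑ λ w → ι (adj G x w) * δ i (c w)

  nbrs-none : ∀ c {x i w} → nbrs c x i ≡ 0 → adj G x w ≡ true → c w ≡ just i → ⊥
  nbrs-none c {x} {i} {w} none xw cw with ∑≡0⇒≡0 (λ w → ι (adj G x w) * δ i (c w)) none w
  ... | eq rewrite xw | cw | ==-refl i = contradiction eq λ ()

  nbrs-some : ∀ c {x i} → 0 < nbrs c x i → ∃[ w ] adj G x w ≡ true × c w ≡ just i
  nbrs-some c {x} {i} some with ∑-positive (λ w → ι (adj G x w) * δ i (c w)) some
  ... | w , p with adj G x w in xw
  ...   | true = w , xw , δ-positive (c w) (≤-trans p (≤-reflexive (+-identityʳ _)))

  by-class : ∀ (c : Colouring) (S : Fin r → Bool) (g : Fin n → ℕ) →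
             ∑ (λ u → ι (S ∋ c u) * g u) ≡ ∑ (λ i → ι (S i) * ∑ (λ u → δ i (c u) * g u))
  by-class c S g = begin
    ∑ (λ u → ι (S ∋ c u) * g u)                         ≡⟨ ∑-cong (λ u → cong (_* g u) (sym (∑-δ S (c u)))) ⟩
    ∑ (λ u → ∑ (λ i → ι (S i) * δ i (c u)) * g u)       ≡⟨ ∑-cong (λ u → expand u) ⟩
    ∑ (λ u → ∑ (λ i → ι (S i) * (δ i (c u) * g u)))     ≡⟨ ∑-comm (λ u i → ι (S i) * (δ i (c u) * g u)) ⟩
    ∑ (λ i → ∑ (λ u → ι (S i) * (δ i (c u) * g u)))     ≡⟨ ∑-cong (λ i → ∑-scale (ι (S i)) (λ u → δ i (c u) * g u)) ⟩
    ∑ (λ i → ι (S i) * ∑ (λ u → δ i (c u) * g u))       ∎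
    where
    open ≡-Reasoning
    expand : ∀ u → ∑ (λ i → ι (S i) * δ i (c u)) * g u ≡ ∑ (λ i → ι (S i) * (δ i (c u) * g u))
    expand u = trans (*-comm _ (g u)) (trans (sym (∑-scale (g u) (λ i → ι (S i) * δ i (c u))))
      (∑-cong λ i → l (g u) (ι (S i)) (δ i (c u))))
      where
      l : ∀ x y z → x * (y * z) ≡ y * (z * x)
      l = solve-∀

  ∑-size : ∀ (c : Colouring) (S : Fin r → Bool) → ∑ (λ u → ι (S ∋ c u)) ≡ ∑ (λ i → ι (S i) * size c i)
  ∑-size c S = trans (∑-cong λ u → sym (*-identityʳ (ι (S ∋ c u)))) (trans (by-class c S (λ _ → 1))
    (∑-cong λ i → cong (ι (S i) *_) (∑-cong λ u → *-identityʳ (δ i (c u)))))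

  _[_↦_] : Colouring → Fin n → Maybe (Fin r) → Colouring
  (c [ u ↦ m ]) w = if w == u then m else c w

  update-same : ∀ c u m → (c [ u ↦ m ]) u ≡ m
  update-same c u m rewrite ==-refl u = refl

  update-other : ∀ c {u m w} → w ≢ u → (c [ u ↦ m ]) w ≡ c w
  update-other c {u} {m} {w} w≢u rewrite dec-false (w ≟ u) w≢u = refl

  -- The additive form avoids truncated subtraction, and the value `nothing` makes it cover
  -- colouring and uncolouring as well as recolouring.
  size-update : ∀ c u m i → size (c [ u ↦ m ]) i + δ i (c u) ≡ size c i + δ i m
  size-update c u m i = begin
    size (c [ u ↦ m ]) i + δ i (c u)
      ≡⟨ cong (size (c [ u ↦ m ]) i +_) (sym (∑-pick u (λ w → δ i (c w)))) ⟩
    size (c [ u ↦ m ]) i + ∑ (λ w → ι (w == u) * δ i (c w))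
      ≡⟨ sym (∑-+ (λ w → δ i ((c [ u ↦ m ]) w)) (λ w → ι (w == u) * δ i (c w))) ⟩
    ∑ (λ w → δ i ((c [ u ↦ m ]) w) + ι (w == u) * δ i (c w))
      ≡⟨ ∑-cong pointwise ⟩
    ∑ (λ w → δ i (c w) + ι (w == u) * δ i m)
      ≡⟨ ∑-+ (λ w → δ i (c w)) (λ w → ι (w == u) * δ i m) ⟩
    size c i + ∑ (λ w → ι (w == u) * δ i m)
      ≡⟨ cong (size c i +_) (∑-pick u (λ _ → δ i m)) ⟩
    size c i + δ i m ∎
    where
    open ≡-Reasoning
    pointwise : ∀ w → δ i ((c [ u ↦ m ]) w) + ι (w == u) * δ i (c w) ≡ δ i (c w) + ι (w == u) * δ i m
    pointwise w with w ≟ u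
    ... | yes refl = l (δ i m) (δ i (c w))
      where
      l : ∀ x y → x + (1 * y) ≡ y + (1 * x)
      l = solve-∀
    ... | no _     = refl

  Proper-update : ∀ c {u i} → Proper c → (∀ {w} → adj G u w ≡ true → c w ≡ just i → ⊥) →
                  Proper (c [ u ↦ just i ])
  Proper-update c {u} {i} pr free {x} {w} xw cx cw with x ≟ u | w ≟ u
  ... | yes refl | yes refl = true≢false xw (irrefl G x)
  ... | yes refl | no _     = free xw (trans cw (sym cx))
  ... | no _     | yes refl = free (trans (Graph.sym G w x) xw) (trans cx (sym cw))
  ... | no _     | no _     = pr xw cx cw

  Proper-uncolour : ∀ c {u} → Proper c → Proper (c [ u ↦ nothing ])
  Proper-uncolour c {u} pr {x} {w} xw cx cw with x ≟ u | w ≟ u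
  ... | no _ | no _ = pr xw cx cw

  -- A recolouring that frees a place in class V and fills one in a class of B, by
  -- moving vertices only between classes of A.
  record Shift (c : Colouring) (A B : Fin r → Bool) (V : Fin r) : Set where
    field
      colour   : Colouring
      proper   : Proper colour
      target   : Fin r
      target∈B : B target ≡ true
      sizes    : ∀ i → size colour i + δ i (just V) ≡ size c i + δ i (just target)
      shrinks  : ∀ {w} → colour w ≡ just V → c w ≡ just V
      outside  : ∀ {w} → A ∋ c w ≡ false → colour w ≡ c w
      base     : ∀ {w i} → c w ≡ just i → B i ≡ true → colour w ≡ c w
      stays    : ∀ w → A ∋ colour w ≡ A ∋ c w
      domain   : ∀ w → is-just (colour w) ≡ is-just (c w)

  -- Closed sets of classes and accessibility

  Closed : Colouring → (Fin r → Bool) → (Fin r → Bool) → Set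
  Closed c 𝒰 A = ∀ {V U x} → 𝒰 V ≡ true → A V ≡ false → A U ≡ true → c x ≡ just V → 0 < nbrs c x U

  record Accessible (c : Colouring) (𝒰 B : Fin r → Bool) : Set where
    field
      set    : Fin r → Bool
      B⊆     : ∀ i → B i ≡ true → set i ≡ true
      ⊆𝒰     : ∀ i → set i ≡ true → 𝒰 i ≡ true
      closed : Closed c 𝒰 set
      shift  : ∀ {V} → set V ≡ true → Shift c set B V

  module _ (c : Colouring) (pr : Proper c) (𝒰 B : Fin r → Bool) (B⊆𝒰 : ∀ i → B i ≡ true → 𝒰 i ≡ true) where

    private
      -- A backward search along arcs from `B`: as long as a vertex `x` of a class `V` in `𝒰` but
      -- outside `A` misses a class `U` of `A`, the class `V` joins `A`. The search stops only when
      -- no arc enters `A` from `𝒰`; `k` bounds the number of classes still outside.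
      grow : ∀ k A → card (not ∘ A) ≤ k → (∀ i → B i ≡ true → A i ≡ true) →
             (∀ i → A i ≡ true → 𝒰 i ≡ true) → (∀ {V} → A V ≡ true → Shift c A B V) → Accessible c 𝒰 B
      grow k A bound B⊆A A⊆𝒰 sh with any? (λ x → any? (λ U →
        ((λ i → 𝒰 i ∧ not (A i)) ∋ c x) Bool.≟ true ×-dec (A U Bool.≟ true ×-dec (nbrs c x U ℕ.≟ 0))))
      grow k A bound B⊆A A⊆𝒰 sh | no ¬move = record
        { set = A ; B⊆ = B⊆A ; ⊆𝒰 = A⊆𝒰 ; closed = closed ; shift = sh }
        where
        closed : Closed c 𝒰 A
        closed {V} {U} {x} 𝒰V AV AU cx with nbrs c x U in eq
        ... | suc _ = s≤s z≤n
        ... | zero  = contradiction (x , U , subst (λ m → ((λ i → 𝒰 i ∧ not (A i)) ∋ m) ≡ true) (sym cx) (true-∧ 𝒰V (cong not AV)) , AU , eq) ¬move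
      grow k A bound B⊆A A⊆𝒰 sh | yes (x , U , movable , AU , none) with ∋-positive (λ i → 𝒰 i ∧ not (A i)) (c x) movable
      ... | V , cx , p with A V in AV | ∧-true {𝒰 V} p
      ...   | true  | _ , ()
      ...   | false | 𝒰V , _ with k
      ...     | zero  = contradiction (≤-trans (subst (λ b → 1 ≤ ι (not b)) (sym AV) ≤-refl) (≤-trans (term≤∑ (ι ∘ not ∘ A) V) bound)) λ ()
      ...     | suc k′ = grow k′ A′ bound′ (λ i Bi → A⊆A′ i (B⊆A i Bi)) A′⊆𝒰 sh′
        where
        A′ : Fin r → Bool
        A′ i = (i == V) ∨ A i
        A′V : A′ V ≡ true
        A′V rewrite ==-refl V = refl
        A⊆A′ : ∀ i → A i ≡ true → A′ i ≡ true
        A⊆A′ i Ai with i == V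
        ... | true  = refl
        ... | false = Ai
        A′⊆𝒰 : ∀ i → A′ i ≡ true → 𝒰 i ≡ true
        A′⊆𝒰 i A′i with i ≟ V
        ... | yes refl = 𝒰V
        ... | no _     = A⊆𝒰 i A′i
        count-A′ : ∀ i → ι (not (A i)) ≡ ι (i == V) * 1 + ι (not (A′ i))
        count-A′ i with i ≟ V
        ... | yes refl rewrite AV = refl
        ... | no _     = refl
        bound′ : card (not ∘ A′) ≤ k′
        bound′ = s≤s⁻¹ (≤-trans (≤-reflexive (sym (trans (∑-cong count-A′) (trans (∑-+ (λ i → ι (i == V) * 1) (ι ∘ not ∘ A′)) (cong (_+ card (not ∘ A′)) (∑-pick V (λ _ → 1))))))) bound)
        A∋⊆A′∋ : ∀ m → A ∋ m ≡ true → A′ ∋ m ≡ true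
        A∋⊆A′∋ (just i) = A⊆A′ i
        A′∌⊆A∌ : ∀ m → A′ ∋ m ≡ false → A ∋ m ≡ false
        A′∌⊆A∌ m p with A ∋ m in eq
        ... | false = refl
        ... | true  = ⊥-elim (true≢false (A∋⊆A′∋ m eq) p)
        weaken : ∀ {X} → Shift c A B X → Shift c A′ B X
        weaken s = record
          { colour = colour ; proper = proper ; target = target ; target∈B = target∈B ; sizes = sizes
          ; shrinks = shrinks ; outside = λ {w} p → outside (A′∌⊆A∌ (c w) p) ; base = base
          ; stays = stays′ ; domain = domain }
          where
          open Shift s
          stays′ : ∀ w → A′ ∋ colour w ≡ A′ ∋ c w
          stays′ w with A ∋ c w in eq
          ... | false = cong (A′ ∋_) (outside eq)
          ... | true  = trans (A∋⊆A′∋ (colour w) (trans (stays w) eq)) (sym (A∋⊆A′∋ (c w) eq))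
        new : Shift c A′ B V
        new = record
          { colour = c″ ; proper = Proper-update colour proper free ; target = target ; target∈B = target∈B
          ; sizes = sizes″ ; shrinks = shrinks″ ; outside = outside″ ; base = base″ ; stays = stays″ ; domain = domain″ }
          where
          -- The shift freeing a place in `U` is performed first. It brings no new vertex into `U`
          -- and leaves `x` alone, so `x` still misses `U` and can move there from `V`.
          open Shift (sh AU)
          c″ = colour [ x ↦ just U ]
          free : ∀ {w} → adj G x w ≡ true → colour w ≡ just U → ⊥
          free xw cw = nbrs-none c none xw (shrinks cw)
          colour-x : colour x ≡ just V
          colour-x = trans (outside (trans (cong (A ∋_) cx) AV)) cx
          sizes″ : ∀ i → size c″ i + δ i (just V) ≡ size c i + δ i (just target)
          sizes″ i = trans (subst (λ m → size c″ i + δ i m ≡ size colour i + δ i (just U)) colour-x (size-update colour x (just U) i)) (sizes i)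
          shrinks″ : ∀ {w} → c″ w ≡ just V → c w ≡ just V
          shrinks″ {w} cw with w ≟ x
          ... | yes refl = cx
          ... | no _     = trans (sym (outside (trans (sym (stays w)) (trans (cong (A ∋_) cw) AV)))) cw
          moved≢ : ∀ {w} → c w ≢ just V → w ≢ x
          moved≢ cw refl = cw cx
          outside″ : ∀ {w} → A′ ∋ c w ≡ false → c″ w ≡ c w
          outside″ {w} p = trans (update-other colour (moved≢ λ cw → true≢false A′V (trans (sym (cong (A′ ∋_) cw)) p))) (outside (A′∌⊆A∌ (c w) p))
          base″ : ∀ {w i} → c w ≡ just i → B i ≡ true → c″ w ≡ c w
          base″ {w} {i} cw Bi = trans (update-other colour (moved≢ λ cw′ → true≢false (B⊆A V (subst (λ j → B j ≡ true) (just-injective (trans (sym cw) cw′)) Bi)) AV)) (base cw Bi)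
          stays″ : ∀ w → A′ ∋ c″ w ≡ A′ ∋ c w
          stays″ w with w ≟ x
          ... | yes refl = trans (A⊆A′ U AU) (sym (trans (cong (A′ ∋_) cx) A′V))
          ... | no _     = Shift.stays (weaken (sh AU)) w
          domain″ : ∀ w → is-just (c″ w) ≡ is-just (c w)
          domain″ w with w ≟ x
          ... | yes refl = sym (cong is-just cx)
          ... | no _     = domain w
        sh′ : ∀ {X} → A′ X ≡ true → Shift c A′ B X
        sh′ {X} p with X ≟ V
        ... | yes refl = new
        ... | no _     = weaken (sh p)

    accessible : Accessible c 𝒰 B
    accessible = grow _ B ≤-refl (λ _ p → p) B⊆𝒰 λ {V} BV → record
      { colour = c ; proper = pr ; target = V ; target∈B = BV ; sizes = λ _ → refl ; shrinks = λ p → p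
      ; outside = λ _ → refl ; base = λ _ _ → refl ; stays = λ _ → refl ; domain = λ _ → refl }

-- Extending an equitable colouring by one vertex

does-true : ∀ {P : Set} (p? : Dec P) → does p? ≡ true → P
does-true (yes p) _ = p

module Extension {n d r : ℕ} (G : Graph n) (degenerate : Degenerate d G) where

  open Sparse G degenerate
  open Colourings G r

  nbrs-unique : ∀ c {x i u w} → nbrs c x i ≡ 1 → adj G x u ≡ true → c u ≡ just i →
                adj G x w ≡ true → c w ≡ just i → u ≡ w
  nbrs-unique c {x} {i} {u} {w} one xu cu xw cw with u ≟ w
  ... | yes eq = eq
  ... | no u≢w = contradiction (two-terms≤∑ (λ y → ι (adj G x y) * δ i (c y)) u≢w) (<⇒≱ (begin-strict
      nbrs c x i                                               ≡⟨ one ⟩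
      1                                                        <⟨ s≤s (s≤s z≤n) ⟩
      2                                                        ≡⟨ sym (cong₂ _+_ (term xu cu) (term xw cw)) ⟩
      ι (adj G x u) * δ i (c u) + ι (adj G x w) * δ i (c w)    ∎))
    where
    open ≤-Reasoning
    term : ∀ {y} → adj G x y ≡ true → c y ≡ just i → ι (adj G x y) * δ i (c y) ≡ 1
    term xy cy rewrite xy | cy | ==-refl i = refl

  -- Edges between unions of colour classes

  class-edges : ∀ c V U → (∀ {x} → c x ≡ just V → 0 < nbrs c x U) →
                size c V ≤ edgesIn (δ V ∘ c) (δ U ∘ c)
  class-edges c V U hit = ∑-mono pointwise
    where
    pointwise : ∀ x → δ V (c x) ≤ ∑ (λ w → δ V (c x) * δ U (c w) * ι (adj G x w))
    pointwise x with (V ==_) ∋ c x in eq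
    ... | false = z≤n
    ... | true  = ≤-trans (hit (δ-positive (c x) (subst (λ b → 0 < ι b) (sym eq) ≤-refl)))
      (≤-reflexive (∑-cong λ w → l (ι (adj G x w)) (δ U (c w))))
      where
      l : ∀ x y → x * y ≡ (1 * y) * x
      l = solve-∀

  edgesIn-by-class : ∀ (c : Colouring) (S : Fin r → Bool) g →
    edgesIn (λ u → ι (S ∋ c u)) g ≡ ∑ (λ V → ι (S V) * edgesIn (δ V ∘ c) g)
  edgesIn-by-class c S g = begin
    edgesIn (λ u → ι (S ∋ c u)) g
      ≡⟨ ∑-cong (λ u → factor (ι (S ∋ c u)) u) ⟩
    ∑ (λ u → ι (S ∋ c u) * ∑ (λ w → g w * ι (adj G u w)))
      ≡⟨ by-class c S (λ u → ∑ (λ w → g w * ι (adj G u w))) ⟩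
    ∑ (λ V → ι (S V) * ∑ (λ u → δ V (c u) * ∑ (λ w → g w * ι (adj G u w))))
      ≡⟨ ∑-cong (λ V → cong (ι (S V) *_) (∑-cong λ u → sym (factor (δ V (c u)) u))) ⟩
    ∑ (λ V → ι (S V) * edgesIn (δ V ∘ c) g) ∎
    where
    open ≡-Reasoning
    factor : ∀ x u → ∑ (λ w → x * g w * ι (adj G u w)) ≡ x * ∑ (λ w → g w * ι (adj G u w))
    factor x u = trans (∑-cong λ w → *-assoc x (g w) (ι (adj G u w))) (∑-scale x (λ w → g w * ι (adj G u w)))

  ∑-select : ∀ (S : Fin r → Bool) (f : Fin r → ℕ) k → (∀ i → S i ≡ true → k ≤ f i) → card S * k ≤ ∑ (λ i → ι (S i) * f i)
  ∑-select S f k h = ≤-trans (≤-reflexive (trans (*-comm (card S) k) (sym (∑-scale k (ι ∘ S))))) (∑-mono pointwise)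
    where
    pointwise : ∀ i → k * ι (S i) ≤ ι (S i) * f i
    pointwise i with S i in eq
    ... | true  = ≤-trans (≤-reflexive (*-comm k 1)) (*-monoʳ-≤ 1 (h i eq))
    ... | false = ≤-reflexive (*-zeroʳ k)

  block-edges : ∀ (c : Colouring) (S S′ : Fin r → Bool) k →
    (∀ V U → S V ≡ true → S′ U ≡ true → k ≤ edgesIn (δ V ∘ c) (δ U ∘ c)) →
    card S * (card S′ * k) ≤ edgesIn (λ u → ι (S ∋ c u)) (λ u → ι (S′ ∋ c u))
  block-edges c S S′ k h = begin
    card S * (card S′ * k)
      ≤⟨ ∑-select S (λ V → edgesIn (δ V ∘ c) s′) (card S′ * k) (λ V SV → inner V SV) ⟩
    ∑ (λ V → ι (S V) * edgesIn (δ V ∘ c) s′)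
      ≡⟨ sym (edgesIn-by-class c S s′) ⟩
    edgesIn (λ u → ι (S ∋ c u)) s′ ∎
    where
    open ≤-Reasoning
    s′ : Fin n → ℕ
    s′ u = ι (S′ ∋ c u)
    inner : ∀ V → S V ≡ true → card S′ * k ≤ edgesIn (δ V ∘ c) s′
    inner V SV = begin
      card S′ * k
        ≤⟨ ∑-select S′ (λ U → edgesIn (δ U ∘ c) (δ V ∘ c)) k (λ U S′U → ≤-trans (h V U SV S′U) (≤-reflexive (edgesIn-sym (δ V ∘ c) (δ U ∘ c)))) ⟩
      ∑ (λ U → ι (S′ U) * edgesIn (δ U ∘ c) (δ V ∘ c))
        ≡⟨ sym (edgesIn-by-class c S′ (δ V ∘ c)) ⟩
      edgesIn s′ (δ V ∘ c)
        ≡⟨ edgesIn-sym s′ (δ V ∘ c) ⟩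
      edgesIn (δ V ∘ c) s′ ∎

  -- Pairs between `μ` and `κ`, and between `α` and either of them, occur in both orders on the
  -- right. This turns counts between blocks of classes into input for `sparse`.
  tripartite-edges : ∀ α μ κ → 2 * (edgesIn μ κ + edgesIn α (λ u → μ u + κ u)) ≤
                     edgesIn (λ u → α u + (μ u + κ u)) (λ u → α u + (μ u + κ u))
  tripartite-edges α μ κ = begin
    2 * (edgesIn μ κ + edgesIn α β)
      ≡⟨ l (edgesIn μ κ) (edgesIn α β) ⟩
    edgesIn α β + (edgesIn α β + (edgesIn μ κ + edgesIn μ κ))
      ≡⟨ cong (λ x → edgesIn α β + (edgesIn α β + (edgesIn μ κ + x))) (edgesIn-sym μ κ) ⟩
    edgesIn α β + (edgesIn α β + (edgesIn μ κ + edgesIn κ μ))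
      ≤⟨ +-mono-≤ (edgesIn-mono (λ u → ≤-refl {α u}) (λ u → m≤n+m (β u) (α u)))
           (+-monoʳ-≤ (edgesIn α β) (+-mono-≤ (edgesIn-mono (λ u → ≤-refl {μ u}) (λ u → m≤n+m (κ u) (μ u))) (edgesIn-mono (λ u → ≤-refl {κ u}) (λ u → m≤m+n (μ u) (κ u))))) ⟩
    edgesIn α σ + (edgesIn α β + (edgesIn μ β + edgesIn κ β))
      ≡⟨ cong (λ x → edgesIn α σ + (edgesIn α β + x)) (sym (edgesIn-+ μ κ β)) ⟩
    edgesIn α σ + (edgesIn α β + edgesIn β β)
      ≡⟨ cong (edgesIn α σ +_) (sym (edgesIn-+ α β β)) ⟩
    edgesIn α σ + edgesIn σ β
      ≡⟨ cong (edgesIn α σ +_) (edgesIn-sym σ β) ⟩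
    edgesIn α σ + edgesIn β σ
      ≡⟨ sym (edgesIn-+ α β σ) ⟩
    edgesIn σ σ ∎
    where
    open ≤-Reasoning
    β σ : Fin n → ℕ
    β u = μ u + κ u
    σ u = α u + β u
    l : ∀ x y → 2 * (x + y) ≡ y + (y + (x + x))
    l = solve-∀

  colouredNbrs : Colouring → Fin n → ℕ
  colouredNbrs c v = ∑ λ w → ι (adj G v w) * ι (is-just (c w))

  ∑-nbrs : ∀ c v → ∑ (nbrs c v) ≡ colouredNbrs c v
  ∑-nbrs c v = trans (∑-comm (λ i w → ι (adj G v w) * δ i (c w))) (∑-cong λ w →
    trans (∑-scale (ι (adj G v w)) (λ i → δ i (c w))) (cong (ι (adj G v w) *_) (total (c w))))
    where
    total : ∀ m → ∑ (λ i → δ i m) ≡ ι (is-just m)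
    total m = trans (∑-cong λ i → sym (*-identityˡ (δ i m))) (trans (∑-δ (λ _ → true) m) (present m))
      where
      present : ∀ m → ι ((λ _ → true) ∋ m) ≡ ι (is-just m)
      present nothing  = refl
      present (just _) = refl

  record Extended (c : Colouring) (q : ℕ) (v : Fin n) : Set where
    field
      colour : Colouring
      proper : Proper colour
      lower  : ∀ i → q ≤ size colour i
      upper  : ∀ i → size colour i ≤ suc q
      domain : ∀ w → is-just (colour w) ≡ (w == v) ∨ is-just (c w)

  module Step
    (maxDegree : ∀ u → ∑ (ι ∘ adj G u) ≤ r) (0<d : 0 < d) (r≥ : 621 * d ≤ 100 * r)
    (c : Colouring) (c-proper : Proper c) (q : ℕ) (lower : ∀ i → q ≤ size c i) (upper : ∀ i → size c i ≤ suc q)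
    (W : Fin r) (W-small : size c W ≡ q) (v : Fin n) (v∉c : c v ≡ nothing) (v-low : colouredNbrs c v ≤ d) where

    enlarge : ∀ c′ S → Proper c′ → size c S ≡ q → (∀ i → size c′ i ≡ size c i + δ i (just S)) →
              (∀ w → is-just (c′ w) ≡ (w == v) ∨ is-just (c w)) → Extended c q v
    enlarge c′ S pr S-small sizes dom = record
      { colour = c′ ; proper = pr ; domain = dom
      ; lower = λ i → ≤-trans (lower i) (≤-trans (m≤m+n _ _) (≤-reflexive (sym (sizes i))))
      ; upper = upper′ }
      where
      upper′ : ∀ i → size c′ i ≤ suc q
      upper′ i with i ≟ S | sizes i
      ... | yes refl | eq = ≤-reflexive (trans eq (trans (cong (_+ 1) S-small) (+-comm q 1)))
      ... | no _     | eq = ≤-trans (≤-reflexive (trans eq (+-identityʳ _))) (upper i)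

    insert-domain : ∀ c′ {m} → (∀ w → is-just (c′ w) ≡ is-just (c w)) → ∀ w → is-just ((c′ [ v ↦ just m ]) w) ≡ (w == v) ∨ is-just (c w)
    insert-domain c′ dom w with w == v
    ... | true  = refl
    ... | false = dom w

    everything small : Fin r → Bool
    everything _ = true
    small i = does (size c i ℕ.≟ q)

    -- The shift makes room in `i` at the expense of a class of size `q`. As `i` has only lost
    -- vertices, `v` still misses it.
    place-v : ∀ {A} i → Shift c A small i → nbrs c v i ≡ 0 → Extended c q v
    place-v i s none = enlarge (colour [ v ↦ just i ]) target
      (Proper-update colour proper λ vw cw → nbrs-none c none vw (shrinks cw))
      (does-true (size c target ℕ.≟ q) target∈B)
      (λ j → trans (trans (sym (+-identityʳ _)) (subst (λ m → size (colour [ v ↦ just i ]) j + δ j m ≡ size colour j + δ j (just i)) (uncoloured (trans (domain v) (cong is-just v∉c))) (size-update colour v (just i) j))) (sizes j))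
      (insert-domain colour domain)
      where open Shift s

    -- Given a recolouring c₁ that transfers one unit of size from V₀ to T, put y and y′ into W
    -- instead of z, z into V₀ and v into T′, where {T, T′} = {Y, Y′}.
    module Exchange
      (z y y′ : Fin n) (Y Y′ V₀ T T′ : Fin r) (cz : c z ≡ just W)
      (zy : adj G z y ≡ true) (zy′ : adj G z y′ ≡ true)
      (y-solo : nbrs c y W ≡ 1) (y′-solo : nbrs c y′ W ≡ 1) (y≢y′ : y ≢ y′) (yy′ : adj G y y′ ≡ false)
      (c₁ : Colouring) (c₁-proper : Proper c₁)
      (c₁z : c₁ z ≡ just W) (c₁y : c₁ y ≡ just Y) (c₁y′ : c₁ y′ ≡ just Y′)
      (W-same : ∀ {w} → c₁ w ≡ just W → c w ≡ just W)
      (z-free : ∀ {w} → adj G z w ≡ true → c₁ w ≡ just V₀ → w ≡ y ⊎ w ≡ y′)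
      (v-free : ∀ {w} → adj G v w ≡ true → c₁ w ≡ just T′ → ⊥)
      (W≢V₀ : W ≢ V₀) (V₀≢T′ : V₀ ≢ T′) (W≢T′ : W ≢ T′)
      (sizes : ∀ i → size c₁ i + δ i (just V₀) ≡ size c i + δ i (just T))
      (targets : ∀ i → δ i (just T) + δ i (just T′) ≡ δ i (just Y) + δ i (just Y′))
      (c₁-domain : ∀ w → is-just (c₁ w) ≡ is-just (c w)) where

      private
        adjacent≢ : ∀ {u w} → adj G u w ≡ true → w ≢ u
        adjacent≢ {u} uw refl = true≢false uw (irrefl G u)

        y≢z = adjacent≢ zy
        y′≢z = adjacent≢ zy′

        c₂ c₃ c₄ c₅ c₆ : Colouring
        -- `z` leaves `W` before `y` and `y′` enter, being the only neighbour of each of them there.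
        -- It returns in `V₀` once they have left their old classes, which matters when one of them
        -- is the only neighbour of `z` in `V₀`.
        c₂ = c₁ [ z ↦ nothing ]
        c₃ = c₂ [ y ↦ just W ]
        c₄ = c₃ [ y′ ↦ just W ]
        c₅ = c₄ [ z ↦ just V₀ ]
        c₆ = c₅ [ v ↦ just T′ ]

        solo-free : ∀ {x w} → adj G z x ≡ true → nbrs c x W ≡ 1 → adj G x w ≡ true → c₂ w ≡ just W → ⊥
        solo-free {x} {w} zx solo xw cw with w ≟ z
        ... | no w≢z = w≢z (nbrs-unique c solo xw (W-same cw) (trans (Graph.sym G x z) zx) cz)

        proper₃ : Proper c₃
        proper₃ = Proper-update c₂ (Proper-uncolour c₁ c₁-proper) (solo-free zy y-solo)

        proper₄ : Proper c₄
        proper₄ = Proper-update c₃ proper₃ free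
          where
          free : ∀ {w} → adj G y′ w ≡ true → c₃ w ≡ just W → ⊥
          free {w} y′w cw with w ≟ y
          ... | yes refl = true≢false y′w (trans (Graph.sym G y′ y) yy′)
          ... | no _     = solo-free zy′ y′-solo y′w cw

        proper₅ : Proper c₅
        proper₅ = Proper-update c₄ proper₄ free
          where
          free : ∀ {w} → adj G z w ≡ true → c₄ w ≡ just V₀ → ⊥
          free {w} zw cw with w ≟ y′ | w ≟ y | w ≟ z
          ... | yes _   | _       | _       = W≢V₀ (just-injective cw)
          ... | no _    | yes _   | _       = W≢V₀ (just-injective cw)
          ... | no w≢y′ | no w≢y  | no _ with z-free zw cw
          ...   | inj₁ w≡y  = w≢y w≡y
          ...   | inj₂ w≡y′ = w≢y′ w≡y′

        proper₆ : Proper c₆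
        proper₆ = Proper-update c₅ proper₅ free
          where
          free : ∀ {w} → adj G v w ≡ true → c₅ w ≡ just T′ → ⊥
          free {w} vw cw with w ≟ z | w ≟ y′ | w ≟ y
          ... | yes _ | _     | _     = V₀≢T′ (just-injective cw)
          ... | no _  | yes _ | _     = W≢T′ (just-injective cw)
          ... | no _  | no _  | yes _ = W≢T′ (just-injective cw)
          ... | no _  | no _  | no _  = v-free vw cw

        domain₅ : ∀ w → is-just (c₅ w) ≡ is-just (c w)
        domain₅ w with w ≟ z | w ≟ y′ | w ≟ y
        ... | yes refl | _        | _        = sym (cong is-just cz)
        ... | no _     | yes refl | _        = trans (sym (cong is-just c₁y′)) (c₁-domain w)
        ... | no _     | no _     | yes refl = trans (sym (cong is-just c₁y)) (c₁-domain w)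
        ... | no _     | no _     | no _     = c₁-domain w

        c₂y : c₂ y ≡ just Y
        c₂y = trans (update-other c₁ y≢z) c₁y
        c₃y′ : c₃ y′ ≡ just Y′
        c₃y′ = trans (update-other c₂ (λ e → y≢y′ (sym e))) (trans (update-other c₁ y′≢z) c₁y′)
        c₄z : c₄ z ≡ nothing
        c₄z = trans (update-other c₃ (λ e → y′≢z (sym e))) (trans (update-other c₂ (λ e → y≢z (sym e))) (update-same c₁ z nothing))

        step : ∀ c′ u {m m′} i → c′ u ≡ m → size (c′ [ u ↦ m′ ]) i + δ i m ≡ size c′ i + δ i m′
        step c′ u {m′ = m′} i refl = size-update c′ u m′ i

        sizes₆ : ∀ i → size c₆ i ≡ size c i + δ i (just W)
        sizes₆ i = chain (size c i) (size c₁ i) (size c₂ i) (size c₃ i) (size c₄ i) (size c₅ i) (size c₆ i)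
          (δ i (just W)) (δ i (just V₀)) (δ i (just T)) (δ i (just T′)) (δ i (just Y)) (δ i (just Y′))
          (sizes i) (step c₁ z i c₁z) (step c₂ y i c₂y) (step c₃ y′ i c₃y′) (step c₄ z i c₄z)
          (step c₅ v i (uncoloured (trans (domain₅ v) (cong is-just v∉c)))) (targets i)
          where
          chain : ∀ s₀ s₁ s₂ s₃ s₄ s₅ s₆ w v₀ t t′ y y′ → s₁ + v₀ ≡ s₀ + t → s₂ + w ≡ s₁ + 0 → s₃ + y ≡ s₂ + w →
                  s₄ + y′ ≡ s₃ + w → s₅ + 0 ≡ s₄ + v₀ → s₆ + 0 ≡ s₅ + t′ → t + t′ ≡ y + y′ → s₆ ≡ s₀ + w
          -- All seven equations are combined and the common terms cancelled: the changes at `V₀`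
          -- offset each other, `targets` balances the gains of `T` and `T′` against the losses of
          -- `Y` and `Y′`, and `W` gains two vertices for one.
          chain s₀ s₁ s₂ s₃ s₄ s₅ s₆ w v₀ t t′ y y′ e₁ e₂ e₃ e₄ e₅ e₆ e₇ =
            +-cancelʳ-≡ (s₁ + s₂ + s₃ + s₄ + s₅ + v₀ + w + y + y′) s₆ (s₀ + w) (trans
              (trans (l₁ s₁ s₂ s₃ s₄ s₅ s₆ w v₀ y y′) (cong₂ _+_ (cong₂ _+_ (cong₂ _+_ e₁ e₂) (cong₂ _+_ e₃ e₄)) (cong₂ _+_ e₅ e₆)))
              (trans (l₂ s₀ s₁ s₂ s₃ s₄ s₅ w v₀ t t′) (trans (cong (_+ (s₀ + s₁ + s₂ + s₃ + s₄ + s₅ + w + w + v₀)) e₇) (l₃ s₀ s₁ s₂ s₃ s₄ s₅ w v₀ y y′))))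
            where
            l₁ : ∀ s₁ s₂ s₃ s₄ s₅ s₆ w v₀ y y′ → s₆ + (s₁ + s₂ + s₃ + s₄ + s₅ + v₀ + w + y + y′) ≡ ((s₁ + v₀) + (s₂ + w)) + ((s₃ + y) + (s₄ + y′)) + ((s₅ + 0) + (s₆ + 0))
            l₁ = solve-∀
            l₂ : ∀ s₀ s₁ s₂ s₃ s₄ s₅ w v₀ t t′ → ((s₀ + t) + (s₁ + 0)) + ((s₂ + w) + (s₃ + w)) + ((s₄ + v₀) + (s₅ + t′)) ≡ (t + t′) + (s₀ + s₁ + s₂ + s₃ + s₄ + s₅ + w + w + v₀)
            l₂ = solve-∀
            l₃ : ∀ s₀ s₁ s₂ s₃ s₄ s₅ w v₀ y y′ → (y + y′) + (s₀ + s₁ + s₂ + s₃ + s₄ + s₅ + w + w + v₀) ≡ (s₀ + w) + (s₁ + s₂ + s₃ + s₄ + s₅ + v₀ + w + y + y′)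
            l₃ = solve-∀

      exchange : Extended c q v
      exchange = enlarge c₆ W proper₆ W-small sizes₆ (insert-domain c₅ domain₅)

    -- The blocked case: accessible classes and classes missed by `v`

    module Blocked (access : Accessible c everything small)
      (v-hits-A : ∀ i → Accessible.set access i ≡ true → 0 < nbrs c v i) where

      open Accessible access using () renaming (set to A; closed to A-closed; B⊆ to small⊆A)

      𝒞 : Fin r → Bool
      𝒞 i = does (nbrs c v i ℕ.≟ 0)

      a γ : ℕ
      a = card A
      γ = card 𝒞

      𝒞-missed : ∀ {i} → 𝒞 i ≡ true → nbrs c v i ≡ 0
      𝒞-missed {i} = does-true (nbrs c v i ℕ.≟ 0)

      A∩𝒞=∅ : ∀ {i} → 𝒞 i ≡ true → A i ≡ false
      A∩𝒞=∅ {i} 𝒞i with A i in Ai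
      ... | false = refl
      ... | true  = contradiction (v-hits-A i Ai) (<⇒≱ (s≤s (≤-reflexive (𝒞-missed {i} 𝒞i))))

      A-W : A W ≡ true
      A-W = small⊆A W (dec-true (size c W ℕ.≟ q) W-small)

      𝒞-W : 𝒞 W ≡ false
      𝒞-W with 𝒞 W in eq
      ... | false = refl
      ... | true  = ⊥-elim (true≢false A-W (A∩𝒞=∅ {W} eq))

      -- Every class of size `q` reaches itself and so lies in `A`.
      full : ∀ {i} → A i ≡ false → size c i ≡ suc q
      full {i} Ai with size c i ℕ.≟ q in eq
      ... | yes p = ⊥-elim (true≢false (small⊆A i (cong does eq)) Ai)
      ... | no ¬p = ≤-antisym (upper i) (≤∧≢⇒< (lower i) (λ e → ¬p (sym e)))

      1≤a : 1 ≤ a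
      1≤a = ≤-trans (≤-reflexive (sym (cong ι A-W))) (term≤∑ (ι ∘ A) W)

      -- Each class of `A` contains a neighbour of `v`, and these are distinct coloured vertices.
      a≤d : a ≤ d
      a≤d = ≤-trans (∑-mono pointwise) (≤-trans (≤-reflexive (∑-nbrs c v)) v-low)
        where
        pointwise : ∀ i → ι (A i) ≤ nbrs c v i
        pointwise i with A i in Ai
        ... | true  = v-hits-A i Ai
        ... | false = z≤n

      r≤γ+d : r ≤ γ + d
      r≤γ+d = begin
        r                                ≡⟨ sym (∑-one r) ⟩
        ∑ {r} (λ _ → 1)                  ≤⟨ ∑-mono pointwise ⟩
        ∑ (λ i → ι (𝒞 i) + nbrs c v i)   ≡⟨ ∑-+ (ι ∘ 𝒞) (nbrs c v) ⟩
        γ + ∑ (nbrs c v)                 ≤⟨ +-monoʳ-≤ γ (≤-trans (≤-reflexive (∑-nbrs c v)) v-low) ⟩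
        γ + d                            ∎
        where
        open ≤-Reasoning
        pointwise : ∀ i → 1 ≤ ι (𝒞 i) + nbrs c v i
        pointwise i with nbrs c v i
        ... | zero  = s≤s z≤n
        ... | suc _ = s≤s z≤n

      γ≥ : 521 * d ≤ 100 * γ
      γ≥ = +-cancelʳ-≤ (100 * d) _ _ (begin
        521 * d + 100 * d   ≡⟨ sym (*-distribʳ-+ d 521 100) ⟩
        621 * d             ≤⟨ r≥ ⟩
        100 * r             ≤⟨ *-monoʳ-≤ 100 r≤γ+d ⟩
        100 * (γ + d)       ≡⟨ *-distribˡ-+ 100 γ d ⟩
        100 * γ + 100 * d   ∎)
        where open ≤-Reasoning

      -- Edges are counted inside `A ∪ 𝒞`, which has at most `(a + γ) * suc q` vertices. Besides the
      -- edges across the cut, each of the `suc q` vertices of a class of `𝒞` has a neighbour in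
      -- every class of `A`. `sparse` bounds the total, and `suc q` cancels.
      cut-edges : ∀ (M K : Fin r → Bool) → (∀ i → ι (𝒞 i) ≡ ι (M i) + ι (K i)) →
        (∀ V U → M V ≡ true → K U ≡ true → suc q ≤ edgesIn (δ V ∘ c) (δ U ∘ c)) →
        card M * card K + a * γ ≤ d * (a + γ)
      cut-edges M K split between = *-cancelʳ-≤ _ _ (2 * suc q) (begin
        (card M * card K + a * γ) * (2 * suc q)
          ≡⟨ l (card M) (card K) a γ (suc q) ⟩
        2 * (card M * (card K * suc q) + a * (γ * suc q))
          ≤⟨ *-monoʳ-≤ 2 (+-mono-≤ (block-edges c M K (suc q) between) (block-edges c A 𝒞 (suc q) A-𝒞)) ⟩
        2 * (edgesIn μ κ + edgesIn α (λ u → ι (𝒞 ∋ c u)))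
          ≤⟨ *-monoʳ-≤ 2 (+-monoʳ-≤ (edgesIn μ κ) (edgesIn-mono (λ u → ≤-refl {α u}) (≤-reflexive ∘ split∋ ∘ c))) ⟩
        2 * (edgesIn μ κ + edgesIn α (λ u → μ u + κ u))
          ≤⟨ tripartite-edges α μ κ ⟩
        edgesIn (λ u → α u + (μ u + κ u)) (λ u → α u + (μ u + κ u))
          ≤⟨ edgesIn-mono (λ u → ≤-reflexive (union∋ (c u))) (λ u → ≤-reflexive (union∋ (c u))) ⟩
        edgesIn (ι ∘ Q) (ι ∘ Q)
          ≤⟨ sparse (card Q) Q refl ⟩
        2 * d * card Q
          ≤⟨ *-monoʳ-≤ (2 * d) size-Q ⟩
        2 * d * ((a + γ) * suc q)
          ≡⟨ l′ d (a + γ) (suc q) ⟩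
        d * (a + γ) * (2 * suc q) ∎)
        where
        open ≤-Reasoning
        α μ κ : Fin n → ℕ
        α u = ι (A ∋ c u)
        μ u = ι (M ∋ c u)
        κ u = ι (K ∋ c u)
        A∪𝒞 : Fin r → Bool
        A∪𝒞 i = A i ∨ 𝒞 i
        Q : Fin n → Bool
        Q u = A∪𝒞 ∋ c u
        l : ∀ m k a g s → (m * k + a * g) * (2 * s) ≡ 2 * (m * (k * s) + a * (g * s))
        l = solve-∀
        l′ : ∀ d x s → 2 * d * (x * s) ≡ d * x * (2 * s)
        l′ = solve-∀
        A-𝒞 : ∀ V U → A V ≡ true → 𝒞 U ≡ true → suc q ≤ edgesIn (δ V ∘ c) (δ U ∘ c)
        A-𝒞 V U AV 𝒞U = begin
          suc q                             ≡⟨ sym (full {U} (A∩𝒞=∅ {U} 𝒞U)) ⟩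
          size c U                          ≤⟨ class-edges c U V (A-closed refl (A∩𝒞=∅ {U} 𝒞U) AV) ⟩
          edgesIn (δ U ∘ c) (δ V ∘ c)       ≡⟨ edgesIn-sym (δ U ∘ c) (δ V ∘ c) ⟩
          edgesIn (δ V ∘ c) (δ U ∘ c)       ∎
        split∋ : ∀ m → ι (𝒞 ∋ m) ≡ ι (M ∋ m) + ι (K ∋ m)
        split∋ nothing  = refl
        split∋ (just i) = split i
        union : ∀ i → ι (A∪𝒞 i) ≡ ι (A i) + ι (𝒞 i)
        union i with A i in Ai | 𝒞 i in 𝒞i
        ... | true  | true  = ⊥-elim (true≢false Ai (A∩𝒞=∅ {i} 𝒞i))
        ... | true  | false = refl
        ... | false | _     = refl
        union∋ : ∀ m → ι (A ∋ m) + (ι (M ∋ m) + ι (K ∋ m)) ≡ ι (A∪𝒞 ∋ m)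
        union∋ nothing  = refl
        union∋ (just i) = sym (trans (union i) (cong (ι (A i) +_) (split i)))
        size-Q : card Q ≤ (a + γ) * suc q
        size-Q = begin
          card Q                                 ≡⟨ ∑-size c A∪𝒞 ⟩
          ∑ (λ i → ι (A∪𝒞 i) * size c i)         ≤⟨ ∑-mono (λ i → *-monoʳ-≤ (ι (A∪𝒞 i)) (upper i)) ⟩
          ∑ (λ i → ι (A∪𝒞 i) * suc q)            ≡⟨ ∑-cong (λ i → *-comm (ι (A∪𝒞 i)) (suc q)) ⟩
          ∑ (λ i → suc q * ι (A∪𝒞 i))            ≡⟨ ∑-scale (suc q) (ι ∘ A∪𝒞) ⟩
          suc q * card A∪𝒞                       ≡⟨ *-comm (suc q) _ ⟩
          card A∪𝒞 * suc q                       ≡⟨ cong (_* suc q) (trans (∑-cong union) (∑-+ (ι ∘ A) (ι ∘ 𝒞))) ⟩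
          (a + γ) * suc q                        ∎

      _∪_ _∖ᶜ_ : (Fin r → Bool) → (Fin r → Bool) → Fin r → Bool
      (X ∪ Y) i = X i ∨ Y i
      (X ∖ᶜ Y) i = X i ∧ not (Y i)

      _⊆𝒞 : (Fin r → Bool) → Set
      X ⊆𝒞 = ∀ i → X i ≡ true → 𝒞 i ≡ true

      split-off : ∀ {K} → K ⊆𝒞 → ∀ i → ι (𝒞 i) ≡ ι ((𝒞 ∖ᶜ K) i) + ι (K i)
      split-off {K} K⊆𝒞 i with 𝒞 i in 𝒞i | K i in Ki
      ... | true  | true  = refl
      ... | true  | false = refl
      ... | false | false = refl
      ... | false | true  = ⊥-elim (true≢false (K⊆𝒞 i Ki) 𝒞i)

      card-split : ∀ {K} → K ⊆𝒞 → card (𝒞 ∖ᶜ K) + card K ≡ γ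
      card-split {K} K⊆𝒞 = sym (trans (∑-cong (split-off K⊆𝒞)) (∑-+ (ι ∘ (𝒞 ∖ᶜ K)) (ι ∘ K)))

      card-∪ : ∀ X Y → card (X ∪ Y) ≡ card X + card (Y ∖ᶜ X)
      card-∪ X Y = trans (∑-cong pointwise) (∑-+ (ι ∘ X) (ι ∘ (Y ∖ᶜ X)))
        where
        pointwise : ∀ i → ι (X i ∨ Y i) ≡ ι (X i) + ι (Y i ∧ not (X i))
        pointwise i with X i | Y i
        ... | true  | true  = refl
        ... | true  | false = refl
        ... | false | true  = refl
        ... | false | false = refl

      closed-∪ : ∀ {X Y} → Closed c 𝒞 X → Closed c 𝒞 Y → Closed c 𝒞 (X ∪ Y)
      closed-∪ {X} {Y} Xc Yc {V} {U} 𝒞V VX∪Y UX∪Y cx with X V in XV | Y V in YV | X U in XU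
      ... | false | false | true  = Xc 𝒞V XV XU cx
      ... | false | false | false = Yc 𝒞V YV UX∪Y cx

      ∪-⊆𝒞 : ∀ {X Y} → X ⊆𝒞 → Y ⊆𝒞 → (X ∪ Y) ⊆𝒞
      ∪-⊆𝒞 {X} X⊆ Y⊆ i p with X i in Xi
      ... | true  = X⊆ i Xi
      ... | false = Y⊆ i p

      hit-edges : ∀ V U → 𝒞 V ≡ true → (∀ {x} → c x ≡ just V → 0 < nbrs c x U) →
                  suc q ≤ edgesIn (δ V ∘ c) (δ U ∘ c)
      hit-edges V U 𝒞V hit = ≤-trans (≤-reflexive (sym (full {V} (A∩𝒞=∅ {V} 𝒞V)))) (class-edges c V U hit)

      not-true : ∀ {b} → not b ≡ true → b ≡ false
      not-true {false} _ = refl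

      -- By `no-middle-cut` the complement `L` of the closed set `X ∪ Y` is small. As `X` is small
      -- too, at least a third of `𝒞` remains for `K`. The cut between `K` and its complement `M` is
      -- again not a middle one, so `M` is small, and `small-cut-bound` sharpens this to the
      -- estimate needed.
      large-core : ∀ {X Y} → X ⊆𝒞 → Closed c 𝒞 X → 3 * card X < γ → Y ⊆𝒞 → Closed c 𝒞 Y →
        γ ≤ 3 * card (X ∪ Y) → 10 * r + 11 * a ≤ 10 * card (Y ∖ᶜ X) + 24 * d
      large-core {X} {Y} X⊆ Xc X-small Y⊆ Yc X∪Y-big = begin
        10 * r + 11 * a                         ≤⟨ +-monoˡ-≤ (11 * a) (*-monoʳ-≤ 10 r≤γ+d) ⟩
        10 * (γ + d) + 11 * a                   ≡⟨ cong (λ t → 10 * (t + d) + 11 * a) (sym (card-split K⊆)) ⟩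
        10 * (card M + card K + d) + 11 * a     ≡⟨ l (card M) (card K) d a ⟩
        10 * card M + 11 * a + (10 * card K + 10 * d) ≤⟨ +-monoˡ-≤ _ (small-cut-bound (card M) (card K) (card-split K⊆) K-edges 0<d γ≥ a≤d M-small) ⟩
        14 * d + (10 * card K + 10 * d)         ≡⟨ l′ (card K) d ⟩
        10 * card K + 24 * d                    ∎
        where
        open ≤-Reasoning
        K M L : Fin r → Bool
        K = Y ∖ᶜ X
        M = 𝒞 ∖ᶜ K
        L = 𝒞 ∖ᶜ (X ∪ Y)
        l : ∀ m k d a → 10 * (m + k + d) + 11 * a ≡ 10 * m + 11 * a + (10 * k + 10 * d)
        l = solve-∀
        l′ : ∀ k d → 14 * d + (10 * k + 10 * d) ≡ 10 * k + 24 * d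
        l′ = solve-∀
        K⊆ : K ⊆𝒞
        K⊆ i p = Y⊆ i (proj₁ (∧-true p))
        L-edges : card L * card (X ∪ Y) + a * γ ≤ d * (a + γ)
        L-edges = cut-edges L (X ∪ Y) (split-off (∪-⊆𝒞 X⊆ Y⊆)) λ V U LV XYU →
          hit-edges V U (proj₁ (∧-true LV)) (closed-∪ Xc Yc (proj₁ (∧-true LV)) (not-true (proj₂ (∧-true {𝒞 V} LV))) XYU)
        L-small : 3 * card L < γ
        L-small = ≰⇒> λ big → no-middle-cut (card L) (card (X ∪ Y)) (card-split (∪-⊆𝒞 X⊆ Y⊆)) L-edges 0<d γ≥ big X∪Y-big
        K-edges : card M * card K + a * γ ≤ d * (a + γ)
        K-edges = cut-edges M K (split-off K⊆) between
          where
          between : ∀ V U → M V ≡ true → K U ≡ true → suc q ≤ edgesIn (δ V ∘ c) (δ U ∘ c)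
          -- `K` need not be closed, but both directions of domination serve: vertices of `K` have
          -- neighbours in every class of `X`, and vertices of the other classes of `M`, which lie
          -- outside `Y`, have neighbours in every class of `K`.
          between V U MV KU with X V in XV | Y V in YV
          ... | true  | _     = ≤-trans (hit-edges U V (K⊆ U KU) (Xc (K⊆ U KU) (not-true (proj₂ (∧-true {Y U} KU))) XV)) (≤-reflexive (edgesIn-sym (δ U ∘ c) (δ V ∘ c)))
          ... | false | false = hit-edges V U (proj₁ (∧-true MV)) (Yc (proj₁ (∧-true MV)) YV (proj₁ (∧-true KU)))
          ... | false | true  = ⊥-elim (true≢false (proj₂ (∧-true {𝒞 V} MV)) refl)
        K-big : γ ≤ 3 * card K
        K-big = +-cancelʳ-≤ (γ + γ) _ _ (begin
          γ + (γ + γ)                                     ≡⟨ cong (λ t → t + (t + t)) (sym (trans (cong (card L +_) (sym (card-∪ X Y))) (card-split (∪-⊆𝒞 X⊆ Y⊆)))) ⟩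
          t + (t + t)                                     ≡⟨ l″ (card L) (card X) (card K) ⟩
          3 * card K + (3 * card L + 3 * card X)          ≤⟨ +-monoʳ-≤ (3 * card K) (+-mono-≤ (<⇒≤ L-small) (<⇒≤ X-small)) ⟩
          3 * card K + (γ + γ)                            ∎)
          where
          t = card L + (card X + card K)
          l″ : ∀ x y z → (x + (y + z)) + ((x + (y + z)) + (x + (y + z))) ≡ 3 * z + (3 * x + 3 * y)
          l″ = solve-∀
        M-small : 3 * card M < γ
        M-small = ≰⇒> λ big → no-middle-cut (card M) (card K) (card-split K⊆) K-edges 0<d γ≥ big K-big

      -- Discharging onto the vertices of `W`

      module Discharge (N : ℕ) (N-def : N + (34 * d + 10) ≡ 10 * r + 11 * a) where

        open Weights {a} {d} {r} {N} N-def 1≤a r≥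

        module Round (X : Fin r → Bool) (X⊆ : X ⊆𝒞) (Xc : Closed c 𝒞 X) (X-small : 3 * card X < γ) where

          -- `O` consists of the classes of `X` and of the classes outside `A` in which `v` has a
          -- neighbour.
          K O : Fin r → Bool
          K = 𝒞 ∖ᶜ X
          O i = not (A i) ∧ not (K i)

          k o R : ℕ
          k = card K
          o = card O
          R = 2 * D * k + 2 * N * o

          solo : Fin n → Bool
          solo y = does (nbrs c y W ℕ.≟ 1)

          soloNbr otherNbr onlyNbr : Fin n → Fin n → Bool
          soloNbr z y = (K ∋ c y) ∧ (adj G z y ∧ solo y)
          otherNbr z y = (K ∋ c y) ∧ (adj G z y ∧ not (solo y))
          onlyNbr z y = soloNbr z y ∧ ((λ i → does (nbrs c z i ℕ.≟ 1)) ∋ c y)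

          -- A vertex sends this weight to each of its neighbours in `W`. Doubling it for solo
          -- vertices guarantees that every vertex of `K` sends at least `2 * D` altogether.
          ω : Fin n → ℕ
          ω y = D * (ι (K ∋ c y) * (1 + ι (solo y))) + 2 * N * ι (O ∋ c y)

          Φ : Fin n → ℕ
          Φ z = ∑ λ y → ι (adj G z y) * ω y

          K∩A=∅ : ∀ {i} → K i ≡ true → A i ≡ false
          K∩A=∅ {i} Ki = A∩𝒞=∅ {i} (proj₁ (∧-true Ki))

          k+o+a≡r : k + o + a ≡ r
          k+o+a≡r = trans (cong (_+ a) (sym (∑-+ (ι ∘ K) (ι ∘ O)))) (trans (sym (∑-+ (λ i → ι (K i) + ι (O i)) (ι ∘ A))) (trans (∑-cong pointwise) (∑-one r)))
            where
            pointwise : ∀ i → ι (K i) + ι (O i) + ι (A i) ≡ 1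
            pointwise i with K i in Ki | A i in Ai
            ... | true  | true  = ⊥-elim (true≢false Ai (K∩A=∅ {i} Ki))
            ... | true  | false = refl
            ... | false | true  = refl
            ... | false | false = refl

          K+X : k + card X ≡ γ
          K+X = card-split X⊆

          -- This is `large-core` for `Y = 𝒞`, which is vacuously closed within itself.
          K-large : 10 * r + 11 * a ≤ 10 * k + 24 * d
          K-large = large-core X⊆ Xc X-small (λ _ p → p) (λ 𝒞V ¬𝒞V → ⊥-elim (true≢false 𝒞V ¬𝒞V))
            (≤-trans (≤-reflexive (sym (trans (card-∪ X 𝒞) (trans (+-comm (card X) k) K+X)))) (m≤n*m _ 3))

          K∩O : ∀ m → K ∋ m ≡ true → O ∋ m ≡ true → ⊥
          K∩O (just i) Ki Oi = true≢false (proj₂ (∧-true {not (A i)} Oi)) (cong not Ki)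

          -- A solo neighbour in `K` weighs `2 * D = 2 * N + 20 * a`. Any other neighbour weighs at
          -- most `2 * N`; for those in `K` this is `D ≤ 2 * N`, where `10 * a ≤ N` enters.
          few-solo : ∀ z → 10 * a ≤ N → ∑ (ι ∘ soloNbr z) ≤ suc d → Φ z ≤ R
          few-solo z 10a≤N t≤ = begin
            Φ z                                                                ≤⟨ ∑-mono pointwise ⟩
            ∑ (λ y → 2 * N * ι (adj G z y) + 20 * a * ι (soloNbr z y))         ≡⟨ ∑-+ (λ y → 2 * N * ι (adj G z y)) (λ y → 20 * a * ι (soloNbr z y)) ⟩
            ∑ (λ y → 2 * N * ι (adj G z y)) + ∑ (λ y → 20 * a * ι (soloNbr z y)) ≡⟨ cong₂ _+_ (∑-scale (2 * N) (ι ∘ adj G z)) (∑-scale (20 * a) (ι ∘ soloNbr z)) ⟩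
            2 * N * ∑ (ι ∘ adj G z) + 20 * a * ∑ (ι ∘ soloNbr z)               ≤⟨ +-mono-≤ (*-monoʳ-≤ (2 * N) (maxDegree z)) (*-monoʳ-≤ (20 * a) t≤) ⟩
            2 * N * r + 20 * a * suc d                                         ≤⟨ few-solo-bound k+o+a≡r K-large ⟩
            R                                                                  ∎
            where
            open ≤-Reasoning
            l₁ : ∀ N a → 1 * ((N + 10 * a) * (1 * 2) + 2 * N * 0) ≡ 2 * N * 1 + 20 * a * 1
            l₁ = solve-∀
            l₂ : ∀ N a → 1 * ((N + 10 * a) * (1 * 1) + 2 * N * 0) ≡ N + 10 * a
            l₂ = solve-∀
            l₃ : ∀ N a → N + N ≡ 2 * N * 1 + 20 * a * 0
            l₃ = solve-∀
            l₄ : ∀ N a x → 1 * ((N + 10 * a) * 0 + 2 * N * 1) ≡ 2 * N * 1 + 20 * a * 0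
            l₄ = solve-∀
            l₅ : ∀ N a → 1 * ((N + 10 * a) * 0 + 2 * N * 0) ≡ 0
            l₅ = solve-∀
            pointwise : ∀ y → ι (adj G z y) * ω y ≤ 2 * N * ι (adj G z y) + 20 * a * ι (soloNbr z y)
            pointwise y with adj G z y | K ∋ c y in Ky | O ∋ c y in Oy | solo y
            ... | false | _     | _     | _     = z≤n
            ... | true  | true  | true  | _     = ⊥-elim (K∩O (c y) Ky Oy)
            ... | true  | true  | false | true  = ≤-reflexive (l₁ N a)
            ... | true  | true  | false | false = ≤-trans (≤-reflexive (l₂ N a)) (≤-trans (+-monoʳ-≤ N 10a≤N) (≤-reflexive (l₃ N a)))
            ... | true  | false | true  | s     = ≤-reflexive (l₄ N a (1 + ι s))
            ... | true  | false | false | s     = ≤-trans (≤-reflexive (l₅ N a)) z≤n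

          -- Each neighbour of `z` has a budget of `3 * D`. A solo one in `K` weighs `2 * D` and
          -- saves `D`, a non-solo one in `K` weighs `D` and saves `2 * D`, and one in `O` weighs
          -- `2 * N`, which is within budget.
          weighing : ∀ z → Φ z + D * ∑ (λ y → ι (soloNbr z y) + 2 * ι (otherNbr z y)) ≤ 3 * D * r
          weighing z = begin
            Φ z + D * ∑ (λ y → ι (soloNbr z y) + 2 * ι (otherNbr z y))
              ≡⟨ cong (Φ z +_) (sym (∑-scale D (λ y → ι (soloNbr z y) + 2 * ι (otherNbr z y)))) ⟩
            Φ z + ∑ (λ y → D * (ι (soloNbr z y) + 2 * ι (otherNbr z y)))
              ≡⟨ sym (∑-+ (λ y → ι (adj G z y) * ω y) (λ y → D * (ι (soloNbr z y) + 2 * ι (otherNbr z y)))) ⟩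
            ∑ (λ y → ι (adj G z y) * ω y + D * (ι (soloNbr z y) + 2 * ι (otherNbr z y)))
              ≤⟨ ∑-mono pointwise ⟩
            ∑ (λ y → 3 * D * ι (adj G z y))
              ≡⟨ ∑-scale (3 * D) (ι ∘ adj G z) ⟩
            3 * D * ∑ (ι ∘ adj G z)
              ≤⟨ *-monoʳ-≤ (3 * D) (maxDegree z) ⟩
            3 * D * r ∎
            where
            open ≤-Reasoning
            l₁ : ∀ D N → 1 * (D * (1 * 2) + 2 * N * 0) + D * 1 ≡ 3 * D * 1
            l₁ = solve-∀
            l₂ : ∀ D N → 1 * (D * (1 * 1) + 2 * N * 0) + D * 2 ≡ 3 * D * 1
            l₂ = solve-∀
            l₃ : ∀ N a → 1 * ((N + 10 * a) * 0 + 2 * N * 1) + (N + 10 * a) * 0 + (N + 30 * a) ≡ 3 * (N + 10 * a) * 1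
            l₃ = solve-∀
            l₄ : ∀ D N → 1 * (D * 0 + 2 * N * 0) + D * 0 ≡ 0
            l₄ = solve-∀
            l₅ : ∀ D → 0 + D * 0 ≡ 0
            l₅ = solve-∀
            zero-other : ∀ b → ι (b ∧ false) + 2 * ι (b ∧ false) ≡ 0
            zero-other true  = refl
            zero-other false = refl
            pointwise : ∀ y → ι (adj G z y) * ω y + D * (ι (soloNbr z y) + 2 * ι (otherNbr z y)) ≤ 3 * D * ι (adj G z y)
            pointwise y with adj G z y | K ∋ c y in Ky | O ∋ c y in Oy | solo y
            ... | false | b     | _     | _     = ≤-trans (≤-reflexive (trans (cong (λ t → 0 + D * t) (zero-other b)) (l₅ D))) z≤n
            ... | true  | true  | true  | _     = ⊥-elim (K∩O (c y) Ky Oy)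
            ... | true  | true  | false | true  = ≤-reflexive (l₁ D N)
            ... | true  | true  | false | false = ≤-reflexive (l₂ D N)
            ... | true  | false | true  | s     = ≤-trans (m≤m+n _ (N + 30 * a)) (≤-reflexive (l₃ N a))
            ... | true  | false | false | s     = ≤-trans (≤-reflexive (l₄ D N)) z≤n

          -- Under `η` every class of `H` carries at least 2: two neighbours carry 1 each, a single
          -- non-solo neighbour carries 2, and a single solo neighbour carries 1 and another 1 as an
          -- `onlyNbr`. The latter extra units number at most `d`, so the savings `h` in `weighing`
          -- are at least `2 * card H - d`.
          many-hits : ∀ z Y → Y ⊆𝒞 → (∀ V → Y V ≡ true → 0 < nbrs c z V) → ∑ (ι ∘ onlyNbr z) ≤ d →
                      10 * r + 11 * a ≤ 10 * card (Y ∖ᶜ X) + 24 * d → Φ z ≤ R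
          many-hits z Y Y⊆ hits u≤d core = +-cancelʳ-≤ (D * h) _ _ (begin
            Φ z + D * h                     ≤⟨ weighing z ⟩
            3 * D * r                       ≤⟨ +-cancelʳ-≤ (D * d) _ _ hits-bound ⟩
            D * h + R                       ≡⟨ +-comm (D * h) R ⟩
            R + D * h                       ∎)
            where
            open ≤-Reasoning
            h = ∑ (λ y → ι (soloNbr z y) + 2 * ι (otherNbr z y))
            H = Y ∖ᶜ X
            η : Fin n → ℕ
            η y = ι (onlyNbr z y) + (ι (soloNbr z y) + 2 * ι (otherNbr z y))
            H⊆K : ∀ {i} → H i ≡ true → K i ≡ true
            H⊆K {i} Hi = true-∧ (Y⊆ i (proj₁ (∧-true Hi))) (proj₂ (∧-true {Y i} Hi))
            K∋ : ∀ {V y} → H V ≡ true → c y ≡ just V → K ∋ c y ≡ true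
            K∋ {V} HV cy = trans (cong (K ∋_) cy) (H⊆K {V} HV)
            η-other : ∀ {y} → otherNbr z y ≡ true → 2 ≤ η y
            η-other {y} p = begin
              2 * 1                                             ≡⟨ sym (cong (λ b → 2 * ι b) p) ⟩
              2 * ι (otherNbr z y)                              ≤⟨ m≤n+m _ (ι (soloNbr z y)) ⟩
              ι (soloNbr z y) + 2 * ι (otherNbr z y)            ≤⟨ m≤n+m _ (ι (onlyNbr z y)) ⟩
              η y                                               ∎
            η-solo : ∀ {y} → soloNbr z y ≡ true → ι (onlyNbr z y) + 1 ≤ η y
            η-solo {y} p = +-monoʳ-≤ (ι (onlyNbr z y)) (≤-trans (≤-reflexive (sym (cong ι p))) (m≤m+n _ _))
            at : ∀ {V y m} → c y ≡ just V → m ≤ η y → m ≤ δ V (c y) * η y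
            at {V} {y} cy le = ≤-trans le (≤-reflexive (sym (trans (cong (_* η y) (trans (cong (δ V) cy) (δ-refl V))) (+-identityʳ (η y)))))
            nbr-weight : ∀ {V y} → H V ≡ true → adj G z y ≡ true → c y ≡ just V → ι (onlyNbr z y) + 1 ≤ η y
            nbr-weight {V} {y} HV zy cy = by-solo (solo y) refl
              where
              by-solo : ∀ b → solo y ≡ b → ι (onlyNbr z y) + 1 ≤ η y
              by-solo true  sy = η-solo (true-∧ (K∋ {V} HV cy) (true-∧ zy sy))
              by-solo false sy = ≤-trans (+-monoˡ-≤ 1 (ι≤1 (onlyNbr z y))) (η-other (true-∧ (K∋ {V} HV cy) (true-∧ zy (cong not sy))))
            in-class : ∀ V → H V ≡ true → 2 ≤ ∑ (λ y → δ V (c y) * η y)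
            in-class V HV with nbrs-some c {z} {V} (hits V (proj₁ (∧-true HV))) | nbrs c z V ℕ.≟ 1
            ... | y , zy , cy | yes one = ≤-trans (at cy (by-solo (solo y) refl)) (term≤∑ (λ y → δ V (c y) * η y) y)
              where
              by-solo : ∀ b → solo y ≡ b → 2 ≤ η y
              by-solo true sy = ≤-trans (≤-reflexive (sym (cong (λ b → ι b + 1) only))) (η-solo s)
                where
                s : soloNbr z y ≡ true
                s = true-∧ (K∋ {V} HV cy) (true-∧ zy sy)
                only : onlyNbr z y ≡ true
                only = true-∧ s (trans (cong ((λ i → does (nbrs c z i ℕ.≟ 1)) ∋_) cy) (dec-true (nbrs c z V ℕ.≟ 1) one))
              by-solo false sy = η-other (true-∧ (K∋ {V} HV cy) (true-∧ zy (cong not sy)))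
            ... | y , zy , cy | no ¬one = by-second second
              where
              one-at : ∀ x → adj G z x ≡ true → c x ≡ just V → 1 ≤ δ V (c x) * η x
              one-at x zx cx = at cx (≤-trans (m≤n+m 1 _) (nbr-weight {V} HV zx cx))
              -- The indicator of `y` sums to 1, while `z` has at least two neighbours in `V`;
              -- comparing the sums produces one different from `y`.
              second : ∃[ y₂ ] ι (y₂ == y) * 1 < ι (adj G z y₂) * δ V (c y₂)
              second = ∑-witness (≤-<-trans (≤-reflexive (∑-pick y (λ _ → 1))) (≤∧≢⇒< (hits V (proj₁ (∧-true HV))) (λ e → ¬one (sym e))))
              by-second : ∃[ y₂ ] ι (y₂ == y) * 1 < ι (adj G z y₂) * δ V (c y₂) → 2 ≤ ∑ (λ y → δ V (c y) * η y)
              by-second (y₂ , lt) with y₂ ≟ y | adj G z y₂ in zy₂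
              ... | yes _  | true  = contradiction lt (≤⇒≯ (≤-trans (≤-reflexive (+-identityʳ _)) (ι≤1 ((V ==_) ∋ c y₂))))
              ... | no y₂≢ | true  = ≤-trans (+-mono-≤ (one-at y₂ zy₂ (δ-positive (c y₂) (≤-trans lt (≤-reflexive (+-identityʳ _))))) (one-at y zy cy)) (two-terms≤∑ (λ y → δ V (c y) * η y) y₂≢)
            2g≤ : card H * 2 ≤ d + h
            2g≤ = begin
              card H * 2                                    ≤⟨ ∑-select H (λ V → ∑ (λ y → δ V (c y) * η y)) 2 in-class ⟩
              ∑ (λ V → ι (H V) * ∑ (λ y → δ V (c y) * η y)) ≡⟨ sym (by-class c H η) ⟩
              ∑ (λ y → ι (H ∋ c y) * η y)                   ≤⟨ ∑-mono (λ y → ≤-trans (*-monoˡ-≤ (η y) (ι≤1 (H ∋ c y))) (≤-reflexive (+-identityʳ (η y)))) ⟩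
              ∑ η                                           ≡⟨ ∑-+ (ι ∘ onlyNbr z) (λ y → ι (soloNbr z y) + 2 * ι (otherNbr z y)) ⟩
              ∑ (ι ∘ onlyNbr z) + h                         ≤⟨ +-monoˡ-≤ h u≤d ⟩
              d + h                                         ∎
            hits-bound : 3 * D * r + D * d ≤ D * h + R + D * d
            hits-bound = begin
              3 * D * r + D * d              ≡⟨ l₁ D r d ⟩
              D * (3 * r + d)                ≤⟨ many-hits-bound {card H} {k} {o} k+o+a≡r K-large core ⟩
              2 * D * card H + R             ≡⟨ cong (_+ R) (l₂ D (card H)) ⟩
              D * (card H * 2) + R           ≤⟨ +-monoˡ-≤ R (*-monoʳ-≤ D 2g≤) ⟩
              D * (d + h) + R                ≡⟨ l₃ D d h R ⟩
              D * h + R + D * d              ∎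
              where
              l₁ : ∀ D r d → 3 * D * r + D * d ≡ D * (3 * r + d)
              l₁ = solve-∀
              l₂ : ∀ D g → 2 * D * g ≡ D * (g * 2)
              l₂ = solve-∀
              l₃ : ∀ D d h R → D * (d + h) + R ≡ D * h + R + D * d
              l₃ = solve-∀

          class-total : ∀ (S : Fin r → Bool) → (∀ {i} → S i ≡ true → A i ≡ false) → ∑ (λ y → ι (S ∋ c y)) ≡ card S * suc q
          class-total S S∩A=∅ = trans (∑-size c S) (trans (∑-cong pointwise) (trans (∑-scale (suc q) (ι ∘ S)) (*-comm (suc q) (card S))))
            where
            pointwise : ∀ i → ι (S i) * size c i ≡ suc q * ι (S i)
            pointwise i with S i in Si
            ... | true  = trans (cong (1 *_) (full {i} (S∩A=∅ Si))) (*-comm 1 (suc q))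
            ... | false = sym (*-zeroʳ (suc q))

          -- After interchanging the sums, a solo vertex of `K` contributes `2 * D` once, another
          -- vertex of `K` contributes `D` at least twice, and a vertex of `O` contributes `2 * N`
          -- at least once. Each of these classes has `suc q` vertices.
          total-weight : R * suc q ≤ ∑ (λ z → δ W (c z) * Φ z)
          total-weight = begin
            R * suc q
              ≡⟨ l (2 * D) (2 * N) k o (suc q) ⟩
            2 * D * (k * suc q) + 2 * N * (o * suc q)
              ≡⟨ sym (cong₂ (λ x y → 2 * D * x + 2 * N * y) (class-total K (λ {i} → K∩A=∅ {i})) (class-total O (λ {i} Oi → not-true (proj₁ (∧-true Oi))))) ⟩
            2 * D * ∑ (λ y → ι (K ∋ c y)) + 2 * N * ∑ (λ y → ι (O ∋ c y))
              ≡⟨ sym (cong₂ _+_ (∑-scale (2 * D) (λ y → ι (K ∋ c y))) (∑-scale (2 * N) (λ y → ι (O ∋ c y)))) ⟩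
            ∑ (λ y → 2 * D * ι (K ∋ c y)) + ∑ (λ y → 2 * N * ι (O ∋ c y))
              ≡⟨ sym (∑-+ (λ y → 2 * D * ι (K ∋ c y)) (λ y → 2 * N * ι (O ∋ c y))) ⟩
            ∑ (λ y → 2 * D * ι (K ∋ c y) + 2 * N * ι (O ∋ c y))
              ≤⟨ ∑-mono pointwise ⟩
            ∑ (λ y → ω y * nbrs c y W)
              ≡⟨ ∑-cong (λ y → sym (∑-scale (ω y) (λ z → ι (adj G y z) * δ W (c z)))) ⟩
            ∑ (λ y → ∑ (λ z → ω y * (ι (adj G y z) * δ W (c z))))
              ≡⟨ ∑-comm (λ y z → ω y * (ι (adj G y z) * δ W (c z))) ⟩
            ∑ (λ z → ∑ (λ y → ω y * (ι (adj G y z) * δ W (c z))))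
              ≡⟨ ∑-cong (λ z → trans (∑-cong λ y → trans (cong (λ b → ω y * (ι b * δ W (c z))) (Graph.sym G y z)) (l′ (ω y) (ι (adj G z y)) (δ W (c z)))) (∑-scale (δ W (c z)) (λ y → ι (adj G z y) * ω y))) ⟩
            ∑ (λ z → δ W (c z) * Φ z) ∎
            where
            open ≤-Reasoning
            l : ∀ D N k o s → (D * k + N * o) * s ≡ D * (k * s) + N * (o * s)
            l = solve-∀
            l′ : ∀ x y z → x * (y * z) ≡ z * (y * x)
            l′ = solve-∀
            l₁ : ∀ D N → 2 * D * 1 + 2 * N * 0 ≡ (D * (1 * 2) + 2 * N * 0) * 1
            l₁ = solve-∀
            l₂ : ∀ D N → 2 * D * 1 + 2 * N * 0 ≡ (D * (1 * 1) + 2 * N * 0) * 2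
            l₂ = solve-∀
            l₃ : ∀ D N → 2 * D * 0 + 2 * N * 1 ≡ (D * 0 + 2 * N * 1) * 1
            l₃ = solve-∀
            l₄ : ∀ D N → 2 * D * 0 + 2 * N * 0 ≡ 0
            l₄ = solve-∀
            dominated : ∀ y (S : Fin r → Bool) → (∀ {i} → S i ≡ true → A i ≡ false) → S ∋ c y ≡ true → 0 < nbrs c y W
            dominated y S S∩A=∅ Sy with ∋-positive S (c y) Sy
            ... | i , cy , Si = A-closed refl (S∩A=∅ Si) A-W cy
            pointwise : ∀ y → 2 * D * ι (K ∋ c y) + 2 * N * ι (O ∋ c y) ≤ ω y * nbrs c y W
            pointwise y with K ∋ c y in Ky | O ∋ c y in Oy
            ... | true  | true  = ⊥-elim (K∩O (c y) Ky Oy)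
            ... | false | false = ≤-trans (≤-reflexive (l₄ D N)) z≤n
            ... | false | true  = ≤-trans (≤-reflexive (l₃ D N)) (*-monoʳ-≤ (D * 0 + 2 * N * 1) (dominated y O (λ {i} Oi → not-true (proj₁ (∧-true Oi))) Oy))
            ... | true  | false with nbrs c y W ℕ.≟ 1
            ...   | yes one = ≤-reflexive (trans (l₁ D N) (cong₂ (λ b m → (D * (1 * (1 + ι b)) + 2 * N * 0) * m) (sym (dec-true (nbrs c y W ℕ.≟ 1) one)) (sym one)))
            ...   | no ¬one rewrite dec-false (nbrs c y W ℕ.≟ 1) ¬one = ≤-trans (≤-reflexive (l₂ D N)) (*-monoʳ-≤ (D * (1 * 1) + 2 * N * 0) (≤∧≢⇒< (dominated y K (λ {i} → K∩A=∅ {i}) Ky) (λ e → ¬one (sym e))))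

          0<R : 0 < R
          0<R = ≤-trans (*-mono-≤ (*-mono-≤ (s≤s (z≤n {1})) 0<D) 0<k) (m≤m+n _ _)
            where
            0<D : 0 < D
            0<D = ≤-trans (≤-trans (s≤s z≤n) (*-monoʳ-≤ 10 1≤a)) (m≤n+m (10 * a) N)
            0<k : 0 < k
            0<k = +-cancelʳ-< (card X) 0 k (≤-<-trans (m≤n*m (card X) 3) (subst (3 * card X <_) (sym K+X) X-small))

          overweight : (∀ z → c z ≡ just W → Φ z ≤ R) → ⊥
          overweight light = <⇒≱ (*-monoʳ-< R {{>-nonZero 0<R}} (n<1+n q)) (begin
            R * suc q                       ≤⟨ total-weight ⟩
            ∑ (λ z → δ W (c z) * Φ z)       ≤⟨ ∑-mono pointwise ⟩
            ∑ (λ z → R * δ W (c z))         ≡⟨ ∑-scale R (λ z → δ W (c z)) ⟩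
            R * size c W                    ≡⟨ cong (R *_) W-small ⟩
            R * q                           ∎)
            where
            open ≤-Reasoning
            pointwise : ∀ z → δ W (c z) * Φ z ≤ R * δ W (c z)
            pointwise z with (W ==_) ∋ c z in eq
            ... | false = z≤n
            ... | true  = ≤-trans (≤-reflexive (*-comm 1 (Φ z))) (*-monoˡ-≤ 1 (light z (δ-positive (c z) (subst (λ b → 0 < ι b) (sym eq) ≤-refl))))

          -- Exchanges at a vertex of `W`

          record SoloNbr (z y : Fin n) : Set where
            field
              class   : Fin r
              cy      : c y ≡ just class
              𝒞-class : 𝒞 class ≡ true
              K-class : K class ≡ true
              zy      : adj G z y ≡ true
              lonely  : nbrs c y W ≡ 1

          soloNbr⇒ : ∀ z y → soloNbr z y ≡ true → SoloNbr z y
          soloNbr⇒ z y p with ∋-positive K (c y) (proj₁ (∧-true {K ∋ c y} p)) | ∧-true {adj G z y} (proj₂ (∧-true {K ∋ c y} p))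
          ... | i , cy , Ki | zy , sy = record
            { class = i ; cy = cy ; 𝒞-class = proj₁ (∧-true Ki) ; K-class = Ki ; zy = zy ; lonely = does-true (nbrs c y W ℕ.≟ 1) sy }

          W≢𝒞 : ∀ {i} → 𝒞 i ≡ true → W ≢ i
          W≢𝒞 𝒞i refl = true≢false 𝒞i 𝒞-W

          -- No shift is required here: `z` takes the place of `y` in `Y`, where `y` was its only
          -- neighbour, and `v` takes the place of `y′`. The classes differ for the same reason,
          -- `y′` being a second neighbour of `z`.
          exchange-only : ∀ {z y y′} → c z ≡ just W → onlyNbr z y ≡ true → soloNbr z y′ ≡ true → y ≢ y′ → adj G y y′ ≡ false → Extended c q v
          exchange-only {z} {y} {y′} cz only s′ y≢y′ yy′ =
            Exchange.exchange z y y′ Y Y′ Y Y Y′ cz zy zy′ lonely lonely′ y≢y′ yy′ c c-proper cz cy cy′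
              (λ p → p) (λ zw cw → inj₁ (nbrs-unique c one zw cw zy cy)) (nbrs-none c (𝒞-missed {Y′} 𝒞′))
              (W≢𝒞 𝒞-class) Y≢Y′ (W≢𝒞 𝒞′) (λ _ → refl) (λ _ → refl) (λ _ → refl)
            where
            open SoloNbr (soloNbr⇒ z y (proj₁ (∧-true {soloNbr z y} only))) renaming (class to Y)
            open SoloNbr (soloNbr⇒ z y′ s′) using () renaming (class to Y′; cy to cy′; 𝒞-class to 𝒞′; zy to zy′; lonely to lonely′)
            one : nbrs c z Y ≡ 1
            one = does-true (nbrs c z Y ℕ.≟ 1) (trans (sym (cong ((λ i → does (nbrs c z i ℕ.≟ 1)) ∋_) cy)) (proj₂ (∧-true {soloNbr z y} only)))
            Y≢Y′ : Y ≢ Y′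
            Y≢Y′ eq = y≢y′ (nbrs-unique c one zy cy zy′ (trans cy′ (cong just (sym eq))))

          pair : Fin r → Fin r → Fin r → Bool
          pair Y Y′ i = (i == Y) ∨ (i == Y′)

          pair-elim : ∀ {Y Y′ i} → pair Y Y′ i ≡ true → i ≡ Y ⊎ i ≡ Y′
          pair-elim {Y} {Y′} {i} p with i ≟ Y
          ... | yes eq = inj₁ eq
          ... | no _   = inj₂ (does-true (i ≟ Y′) p)

          -- `z` moves into `V`, the shift refills one of `Y`, `Y′`, and `v` refills the other; the
          -- two may coincide. The shift permutes vertices only among classes of `𝒞`, so it leaves
          -- `W` unchanged and `v` still misses all of these classes. It also keeps `y` and `y′` in
          -- place, since their classes form its base.
          exchange-shift : ∀ {z y y′} → c z ≡ just W → (s : SoloNbr z y) (s′ : SoloNbr z y′) → y ≢ y′ → adj G y y′ ≡ false →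
            (acc : Accessible c 𝒞 (pair (SoloNbr.class s) (SoloNbr.class s′))) →
            ∀ V → Accessible.set acc V ≡ true → nbrs c z V ≡ 0 → Extended c q v
          exchange-shift {z} {y} {y′} cz s s′ y≢y′ yy′ acc V AV none = by-target (pair-elim {Y} {Y′} target∈B)
            where
            open SoloNbr s renaming (class to Y)
            open SoloNbr s′ using () renaming (class to Y′; cy to cy′; 𝒞-class to 𝒞′; zy to zy′; lonely to lonely′)
            open Accessible acc renaming (set to A′; ⊆𝒰 to A′⊆𝒞)
            open Shift (shift AV)
            A′-W : A′ W ≡ false
            A′-W with A′ W in eq
            ... | false = refl
            ... | true  = ⊥-elim (true≢false (A′⊆𝒞 W eq) 𝒞-W)
            pair-Y : pair Y Y′ Y ≡ true
            pair-Y rewrite ==-refl Y = refl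
            pair-Y′ : pair Y Y′ Y′ ≡ true
            pair-Y′ with Y′ == Y
            ... | true  = refl
            ... | false = ==-refl Y′
            colour-z : colour z ≡ just W
            colour-z = trans (outside (trans (cong (A′ ∋_) cz) A′-W)) cz
            W-same : ∀ {w} → colour w ≡ just W → c w ≡ just W
            W-same {w} cw = trans (sym (outside (trans (sym (stays w)) (trans (cong (A′ ∋_) cw) A′-W)))) cw
            v-free : ∀ {T′} → A′ T′ ≡ true → ∀ {w} → adj G v w ≡ true → colour w ≡ just T′ → ⊥
            v-free A′T′ {w} vw cw with ∋-positive A′ (c w) (trans (sym (stays w)) (trans (cong (A′ ∋_) cw) A′T′))
            ... | j , cj , A′j = nbrs-none c (𝒞-missed {j} (A′⊆𝒞 j A′j)) vw cj
            V≢ : ∀ {x i} → adj G z x ≡ true → c x ≡ just i → V ≢ i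
            V≢ zx cx refl = nbrs-none c none zx cx
            run : ∀ T′ → A′ T′ ≡ true → V ≢ T′ → (∀ i → δ i (just target) + δ i (just T′) ≡ δ i (just Y) + δ i (just Y′)) → Extended c q v
            run T′ A′T′ V≢T′ targets = Exchange.exchange z y y′ Y Y′ V target T′ cz zy zy′ lonely lonely′ y≢y′ yy′ colour proper
              colour-z (trans (base cy pair-Y) cy) (trans (base cy′ pair-Y′) cy′) W-same
              (λ zw cw → ⊥-elim (nbrs-none c none zw (shrinks cw))) (v-free A′T′)
              (W≢𝒞 (A′⊆𝒞 V AV)) V≢T′ (W≢𝒞 (A′⊆𝒞 T′ A′T′)) sizes targets domain
            by-target : target ≡ Y ⊎ target ≡ Y′ → Extended c q v
            by-target (inj₁ eq) = run Y′ (B⊆ Y′ pair-Y′) (V≢ zy′ cy′) (λ i → cong (λ t → δ i (just t) + δ i (just Y′)) eq)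
            by-target (inj₂ eq) = run Y (B⊆ Y pair-Y) (V≢ zy cy) (λ i → trans (cong (λ t → δ i (just t) + δ i (just Y)) eq) (+-comm (δ i (just Y′)) (δ i (just Y))))

        -- Whenever the classes reaching Y or Y′ form a small closed set together with X, X is
        -- replaced by the union.
        saturate : ∀ fuel X (X⊆ : X ⊆𝒞) (Xc : Closed c 𝒞 X) (X-small : 3 * card X < γ) → γ ≤ card X + fuel → Extended c q v
        saturate zero X X⊆ Xc X-small γ≤ = contradiction X-small (≤⇒≯ (≤-trans γ≤ (≤-trans (≤-reflexive (+-identityʳ _)) (m≤n*m (card X) 3))))
        saturate (suc fuel) X X⊆ Xc X-small γ≤ = conclude (collect at)
          where
          module Here = Round X X⊆ Xc X-small
          at : ∀ z → Extended c q v ⊎ (c z ≡ just W → Here.Φ z ≤ Here.R)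
          at z with ≡-dec _≟_ (c z) (just W) | suc d <? ∑ (ι ∘ Here.soloNbr z)
          ... | no c≢  | _      = inj₂ λ cz → contradiction cz c≢
          ... | yes _  | no few = inj₂ λ _ → Here.few-solo z (10a≤N a≤d) (≮⇒≥ few)
          ... | yes cz | yes many with nonadjacent-pair (Here.soloNbr z) many
          ...   | y , y′ , sy , sy′ , y≢y′ , yy′ = continue (accessible c c-proper 𝒞 (Here.pair Y Y′) B⊆𝒞)
            where
            s = Here.soloNbr⇒ z y sy
            s′ = Here.soloNbr⇒ z y′ sy′
            open Here.SoloNbr s using () renaming (class to Y; 𝒞-class to 𝒞Y; K-class to KY)
            open Here.SoloNbr s′ using () renaming (class to Y′; 𝒞-class to 𝒞Y′)
            B⊆𝒞 : ∀ i → Here.pair Y Y′ i ≡ true → 𝒞 i ≡ true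
            B⊆𝒞 i p with Here.pair-elim {Y} {Y′} {i} p
            ... | inj₁ refl = 𝒞Y
            ... | inj₂ refl = 𝒞Y′
            continue : Accessible c 𝒞 (Here.pair Y Y′) → Extended c q v ⊎ (c z ≡ just W → Here.Φ z ≤ Here.R)
            continue acc with 3 * card (X ∪ Accessible.set acc) <? γ
            ... | yes small′ = inj₁ (saturate fuel (X ∪ A′) (∪-⊆𝒞 X⊆ A′⊆𝒞) (closed-∪ Xc closed) small′ grown)
              where
              open Accessible acc renaming (set to A′; ⊆𝒰 to A′⊆𝒞)
              -- `Y` belongs to `K` and hence not to `X`, so the union is strictly larger and one
              -- unit of fuel pays for it.
              new : 1 ≤ card (A′ ∖ᶜ X)
              new = ≤-trans (≤-reflexive (sym (cong ι (true-∧ (B⊆ Y pair-Y) (proj₂ (∧-true {𝒞 Y} KY)))))) (term≤∑ (ι ∘ (A′ ∖ᶜ X)) Y)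
                where
                pair-Y : Here.pair Y Y′ Y ≡ true
                pair-Y rewrite ==-refl Y = refl
              grown : γ ≤ card (X ∪ A′) + fuel
              grown = begin
                γ                                     ≤⟨ γ≤ ⟩
                card X + suc fuel                     ≡⟨ sym (+-assoc (card X) 1 fuel) ⟩
                card X + 1 + fuel                     ≤⟨ +-monoˡ-≤ fuel (+-monoʳ-≤ (card X) new) ⟩
                card X + card (A′ ∖ᶜ X) + fuel        ≡⟨ cong (_+ fuel) (sym (card-∪ X A′)) ⟩
                card (X ∪ A′) + fuel                  ∎
                where open ≤-Reasoning
            ... | no ¬small with collect missed
              where
              missed : ∀ V → Extended c q v ⊎ (Accessible.set acc V ≡ true → 0 < nbrs c z V)
              missed V with Accessible.set acc V Bool.≟ true | nbrs c z V ℕ.≟ 0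
              ... | no ¬AV | _        = inj₂ λ AV → contradiction AV ¬AV
              ... | yes AV | yes none = inj₁ (Here.exchange-shift cz s s′ y≢y′ yy′ acc V AV none)
              ... | yes AV | no some  = inj₂ λ _ → n≢0⇒n>0 some
            ...   | inj₁ done = inj₁ done
            ...   | inj₂ hits with d <? ∑ (ι ∘ Here.onlyNbr z)
            -- `z` hits every class of `A′`, and `large-core` shows that `A′` without `X` is almost
            -- all of `𝒞`, so the wasted degree bounds the weight.
            ...     | no few = inj₂ λ _ → Here.many-hits z A′ A′⊆𝒞 hits (≮⇒≥ few) (large-core X⊆ Xc X-small A′⊆𝒞 closed (≮⇒≥ ¬small))
              where open Accessible acc renaming (set to A′; ⊆𝒰 to A′⊆𝒞)
            ...     | yes manyOnly with nonadjacent-pair-in (Here.onlyNbr z) (Here.soloNbr z) (λ w p → proj₁ (∧-true p)) manyOnly many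
            ...       | x , x′ , only , sx′ , x≢x′ , xx′ = inj₁ (Here.exchange-only cz only sx′ x≢x′ xx′)
          conclude : Extended c q v ⊎ (∀ z → c z ≡ just W → Here.Φ z ≤ Here.R) → Extended c q v
          conclude (inj₁ done)  = done
          conclude (inj₂ light) = ⊥-elim (Here.overweight light)

      extend-blocked : Extended c q v
      extend-blocked = Discharge.saturate (10 * r + 11 * a ∸ (34 * d + 10)) (m∸n+n≡m (weight-exists {a} {d} {r} 1≤a r≥))
        γ (λ _ → false) (λ _ ()) (λ _ _ ()) ∅-small (m≤n+m γ (card {r} (λ _ → false)))
        where
        ∅-small : 3 * card {r} (λ _ → false) < γ
        ∅-small = subst (λ x → 3 * x < γ) (sym (∑-zero r)) (*-cancelˡ-< 100 0 γ (≤-trans (≤-trans 0<d (m≤n*m d 521)) γ≥))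

    extend : Extended c q v
    extend = by-cases (collect missed)
      where
      acc = accessible c c-proper everything small λ _ _ → refl
      missed : ∀ i → Extended c q v ⊎ (Accessible.set acc i ≡ true → 0 < nbrs c v i)
      missed i with Accessible.set acc i Bool.≟ true | nbrs c v i ℕ.≟ 0
      ... | no ¬Ai | _        = inj₂ λ Ai → contradiction Ai ¬Ai
      ... | yes Ai | yes none = inj₁ (place-v i (Accessible.shift acc Ai) none)
      ... | yes _  | no some  = inj₂ λ _ → n≢0⇒n>0 some
      by-cases : Extended c q v ⊎ (∀ i → Accessible.set acc i ≡ true → 0 < nbrs c v i) → Extended c q v
      by-cases (inj₁ done) = done
      by-cases (inj₂ hits) = Blocked.extend-blocked acc hits

  -- Induction along a degeneracy order

  record Equitable (P : Fin n → Bool) : Set where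
    field
      colour : Colouring
      proper : Proper colour
      base   : ℕ
      lower  : ∀ i → base ≤ size colour i
      upper  : ∀ i → size colour i ≤ suc base
      domain : ∀ w → is-just (colour w) ≡ P w

  -- A vertex `v` of degree at most `d` within `P` is coloured last. When its turn comes, only the
  -- rest of `P` is coloured, so at most `d` of its neighbours are.
  equitable : (∀ u → ∑ (ι ∘ adj G u) ≤ r) → 0 < d → 621 * d ≤ 100 * r →
              ∀ k P → ∑ (ι ∘ P) ≡ k → Equitable P
  equitable maxDegree 0<d r≥ zero P eq = record
    { colour = λ _ → nothing ; proper = λ _ () ; base = 0 ; lower = λ _ → z≤n
    ; upper = λ _ → ≤-trans (≤-reflexive (∑-zero n)) z≤n ; domain = λ w → sym (empty w (∑≡0⇒≡0 (ι ∘ P) eq w)) }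
    where
    empty : ∀ w → ι (P w) ≡ 0 → P w ≡ false
    empty w p with P w
    ... | false = refl
  equitable maxDegree 0<d r≥ (suc k) P eq with ∑-positive (ι ∘ P) (subst (0 <_) (sym eq) (s≤s z≤n))
  ... | u , pu with low-degree P (ι-true pu)
  ... | v , Pv , deg≤d with equitable maxDegree 0<d r≥ k (P ∖ v) (suc-injective (trans (sym (size-∖ P Pv)) eq))
  ... | e = choose (any? λ i → size colour i ℕ.≟ base)
    where
    open Equitable e
    v∉ : colour v ≡ nothing
    v∉ = uncoloured (trans (domain v) (trans (cong (λ b → P v ∧ not b) (==-refl v)) (∧-zeroʳ (P v))))
    v-low : colouredNbrs colour v ≤ d
    v-low = ≤-trans (∑-mono pointwise) deg≤d
      where
      pointwise : ∀ w → ι (adj G v w) * ι (is-just (colour w)) ≤ ι (P w) * ι (adj G v w)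
      pointwise w rewrite domain w with P w
      ... | true  = ≤-trans (*-monoʳ-≤ (ι (adj G v w)) (ι≤1 _)) (≤-reflexive (*-comm (ι (adj G v w)) 1))
      ... | false = ≤-reflexive (*-zeroʳ (ι (adj G v w)))
    restore : ∀ w → (w == v) ∨ is-just (colour w) ≡ P w
    restore w with w ≟ v | domain w
    ... | yes refl | _  = sym Pv
    ... | no _     | dw = trans dw (∧-identityʳ (P w))
    build : ∀ q → (∀ i → q ≤ size colour i) → (∀ i → size colour i ≤ suc q) → ∀ W → size colour W ≡ q → Equitable P
    build q lo hi W W-small = record
      { colour = X.colour ; proper = X.proper ; base = q ; lower = X.lower ; upper = X.upper
      ; domain = λ w → trans (X.domain w) (restore w) }
      where module X = Extended (Step.extend maxDegree 0<d r≥ colour proper q lo hi W W-small v v∉ v-low)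
    choose : Dec (∃[ i ] size colour i ≡ base) → Equitable P
    choose (yes (W , W-small)) = build base lower upper W W-small
    -- If no class has size `base`, all have size `suc base`. The base is raised, and then any class
    -- can serve as `W`; one exists because `r` is positive.
    choose (no ¬small) = build (suc base) grown (λ i → m≤n⇒m≤1+n (upper i)) W (≤-antisym (upper W) (grown W))
      where
      grown : ∀ i → suc base ≤ size colour i
      grown i = ≤∧≢⇒< (lower i) λ e → ¬small (i , sym e)
      W : Fin r
      W = fromℕ< (*-cancelˡ-< 100 0 r (≤-trans (≤-trans 0<d (m≤n*m d 621)) r≥))

-- From the colouring of all vertices to the equitable `Δ`-coloring

theorem3 : (d Δ : ℕ) → 0 < d → 621 * d ≤ 100 * Δ →
    ∀ {n} (G : Graph n) → Degenerate d G → MaxDegreeAtMost G Δ →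
    EquitableColoring G Δ
theorem3 d Δ 0<d Δ≥ {n} G degenerate maxDegree = f , proper-f , balanced
  where
  open Extension {r = Δ} G degenerate
  open Colourings G Δ using (size)
  open Equitable (equitable (λ u → subst (_≤ Δ) (count≡∑ (adj G u)) (maxDegree u)) 0<d Δ≥ (card {n} (λ _ → true)) (λ _ → true) refl)
  value : (m : Maybe (Fin Δ)) → is-just m ≡ true → Fin Δ
  value (just i) _ = i
  value-just : ∀ m p → m ≡ just (value m p)
  value-just (just i) _ = refl
  f : Fin n → Fin Δ
  f u = value (colour u) (domain u)
  colour-f : ∀ u → colour u ≡ just (f u)
  colour-f u = value-just (colour u) (domain u)
  proper-f : ∀ u w → T (adj G u w) → f u ≢ f w
  proper-f u w uw eq = proper (T⇒≡ uw) (colour-f u) (trans (colour-f w) (cong just (sym eq)))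
  classSize-f : ∀ i → classSize f i ≡ size colour i
  classSize-f i = trans (count≡∑ (λ u → does (f u ≟ i))) (∑-cong λ u →
    trans (cong ι (does-⇔ (mk⇔ sym sym) (f u ≟ i) (i ≟ f u))) (cong (δ i) (sym (colour-f u))))
  balanced : ∀ i j → classSize f i ≤ suc (classSize f j)
  balanced i j = subst₂ (λ x y → x ≤ suc y) (sym (classSize-f i)) (sym (classSize-f j)) (≤-trans (upper i) (s≤s (lower j)))
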